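{- Let $G$ be a simple graph with $n$ vertices and vertex set $V$, and let $\chi_f(G)$ denote its fractional chromatic number. Then $$\min\{k : \forall\, w \in \mathbb{R}_+^V,\ \vartheta_k(G;w) \geq w^{T}\mathbf{1}\} \leq \lceil \chi_f(G)\rceil,$$ where $k$ ranges over the integers between $1$ and $n$. In particular, $$h(G) \leq \lceil \chi_f(G)\rceil .$$
   Context: Graphs $G=(V,E)$ are finite and simple with $n=|V|\ge 1$ vertices. $\mathbb{S}^V$ is the set of real symmetric matrices with rows and columns indexed by $V$; $\mathbb{R}_+^V$ is the set of entrywise non-negative vectors indexed by $V$ (also written $w\ge \mathbf{0}$); $\mathbf{1}$ is the all-ones vector; $\sqrt{w}$ is the entrywise square root of $w$; $\langle A,B\rangle=\operatorname{tr}(AB)$ on $\mathbb{S}^V$; $A\preccurlyeq B$ means that $B-A$ is positive semidefinite; $\lambda_1(M)\ge\dots\ge\lambda_n(M)$ are the eigenvalues of $M\in\mathbb{S}^V$ with multiplicity. The condition "$Z_{ij}=0$ for all $ij\notin E$" includes the diagonal positions, so $Z$ has zero diagonal. For $w\in\mathbb{R}_+^V$ and an integer $k$ with $0\le k\le n$, $$\vartheta_k(G;w)=\min\Big\{\sum_{i=1}^k\lambda_i\big(\sqrt{w}\sqrt{w}^{T}+Z\big): Z\in\mathbb{S}^V,\ Z_{ij}=0\ \forall ij\notin E\Big\}.$$ Equivalently (by semidefinite programming duality) $$\vartheta_k(G;w)=\max\big\{\langle\sqrt{w}\sqrt{w}^{T},X\rangle: X\in\mathbb{S}^V,\ \operatorname{tr}X=k,\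 X_{ij}=0\ \forall ij\in E,\ 0\preccurlyeq X\preccurlyeq I\big\},$$ and this second formula defines $\vartheta_k(G;w)$ for every real $k$ with $0\le k\le n$. $h(G)$ is the smallest integer $m\ge1$ such that for all $Z\in\mathbb{S}^V$ with $Z_{ij}=0$ for all $ij\notin E$, $$\lambda_1(Z)+\lambda_n(Z)+\lambda_{n-1}(Z)+\dots+\lambda_{n-m+2}(Z)\le 0,$$ i.e. $\lambda_1(Z)+\sum_{i=1}^{m-1}\lambda_{n+1-i}(Z)\le0$ (for $m=1$ the condition is $\lambda_1(Z)\le0$). The fractional chromatic number is $\chi_f(G)=\min\{\sum_S y_S : y_S\ge 0,\ \sum_{S\ni v}y_S=1\ \forall v\in V\}$, where $S$ ranges over the cocliques (independent sets) of $G$. -}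

module Defs where

open import Algebra.Bundles using (CommutativeRing; Semiring)
open import Algebra.Structures using (IsCommutativeRing)
import Algebra.Definitions.RawSemiring as RawSemiringDefinitions
open import Data.Bool.Base using (if_then_else_)
open import Data.Fin.Base as Fin using (Fin; zero; suc; toℕ; fromℕ<; opposite; punchIn)
open import Data.Fin.Properties using () renaming (_≟_ to _≟ᶠ_)
open import Data.Fin.Subset using (Subset; inside; outside; _∈_)
open import Data.Fin.Subset.Properties using (_∈?_)
open import Data.Nat.Base as ℕ using (ℕ; zero; suc; NonZero)
open import Data.Nat.Properties using (_<?_)
open import Data.Product.Base using (∃-syntax; _×_)
open import Data.Vec.Base using ([]; _∷_)
open import Data.Vec.Functional using (Vector)
open import Level using (0ℓ)
open import Relation.Binary.Core using (Rel)
open import Relation.Binary.Definitions using (Symmetric; Irreflexive)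
open import Relation.Binary.PropositionalEquality.Core using (_≡_)
open import Relation.Binary.Structures using (IsTotalOrder)
open import Relation.Nullary.Decidable.Core using (does)
open import Relation.Nullary.Negation.Core using (¬_)
open import Relation.Unary using (Pred)

IsMinimum : {A : Set} → Rel A 0ℓ → Pred A 0ℓ → Pred A 0ℓ
IsMinimum _≤_ P x = P x × (∀ y → P y → x ≤ y)

-- The real numbers, characterised up to unique isomorphism (assuming
-- excluded middle) as a Dedekind-complete ordered field. Equality is a
-- setoid equality, so that both Cauchy and Dedekind reals are instances.
record Reals : Set₁ where
  infix  4 _≈_ _≤_
  infixl 6 _+_
  infixl 7 _*_
  infix  8 -_
  field
    Carrier           : Set
    _≈_ _≤_           : Rel Carrier 0ℓ
    _+_ _*_           : Carrier → Carrier → Carrier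
    -_                : Carrier → Carrier
    0# 1#             : Carrier
    isCommutativeRing : IsCommutativeRing _≈_ _+_ _*_ -_ 0# 1#
    0≉1               : ¬ 0# ≈ 1#
    inverse           : ∀ x → ¬ x ≈ 0# → ∃[ y ] x * y ≈ 1#
    isTotalOrder      : IsTotalOrder _≈_ _≤_
    +-monoˡ-≤         : ∀ x {y z} → y ≤ z → y + x ≤ z + x
    *-nonNegative     : ∀ {x y} → 0# ≤ x → 0# ≤ y → 0# ≤ x * y

  UpperBound : Pred Carrier 0ℓ → Pred Carrier 0ℓ
  UpperBound S u = ∀ x → S x → x ≤ u

  field
    supremum : (S : Pred Carrier 0ℓ) → ∃[ x ] S x → ∃[ u ] UpperBound S u →
               ∃[ s ] IsMinimum _≤_ (UpperBound S) s

  commutativeRing : CommutativeRing 0ℓ 0ℓ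
  commutativeRing = record { isCommutativeRing = isCommutativeRing }

  open CommutativeRing commutativeRing public
    using (_-_; semiring)

record SimpleGraph (n : ℕ) : Set₁ where
  infix 4 _~_
  field
    _~_    : Rel (Fin n) 0ℓ
    sym    : Symmetric _~_
    irrefl : Irreflexive _≡_ _~_

Coclique : ∀ {n} → SimpleGraph n → Pred (Subset n) 0ℓ
Coclique G S = ∀ i j → i ∈ S → j ∈ S → ¬ i ~ j
  where open SimpleGraph G

module Over (ℝ : Reals) where

  open Reals ℝ
  open RawSemiringDefinitions (Semiring.rawSemiring semiring)
    using (sum; product) renaming (_×_ to _·_)

  Matrix : ℕ → Set
  Matrix n = Fin n → Fin n → Carrier

  IsSymmetric : ∀ {n} → Pred (Matrix n) 0ℓ
  IsSymmetric M = ∀ i j → M i j ≈ M j i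

  scalar : ∀ {n} → Carrier → Matrix n
  scalar t i j = if does (i ≟ᶠ j) then t else 0#

  [-1]^ : ℕ → Carrier
  [-1]^ zero    = 1#
  [-1]^ (suc m) = - [-1]^ m

  -- Laplace expansion along the first row.
  det : ∀ {n} → Matrix n → Carrier
  det {zero}  M = 1#
  det {suc n} M =
    sum λ j → [-1]^ (toℕ j) * M zero j * det (λ i l → M (suc i) (punchIn j l))

  charpoly : ∀ {n} → Matrix n → Carrier → Carrier
  charpoly M t = det (λ i j → scalar t i j - M i j)

  -- μ is the non-increasing list λ₁(M) ≥ ⋯ ≥ λₙ(M) of the eigenvalues with
  -- multiplicity; λᵢ(M) is μ at the index of value i - 1. The field being
  -- infinite, agreement at every t is equality of polynomials.
  record IsSpectrum {n} (M : Matrix n) (μ : Vector Carrier n) : Set where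
    field
      nonIncreasing : ∀ {i j} → i Fin.≤ j → μ j ≤ μ i
      roots         : ∀ t → charpoly M t ≈ product (λ i → t - μ i)

  λ₁ : ∀ {n} .{{_ : NonZero n}} → Vector Carrier n → Carrier
  λ₁ {n} μ = μ (fromℕ< (ℕ.>-nonZero⁻¹ n))

  sumFirst : ∀ {n} → ℕ → Vector Carrier n → Carrier
  sumFirst k μ = sum λ i → if does (toℕ i <? k) then μ i else 0#

  sumLast : ∀ {n} → ℕ → Vector Carrier n → Carrier
  sumLast k μ = sumFirst k (λ i → μ (opposite i))

  NonNegative : ∀ {n} → Pred (Vector Carrier n) 0ℓ
  NonNegative w = ∀ i → 0# ≤ w i

  IsSqrt : ∀ {n} → Vector Carrier n → Pred (Vector Carrier n) 0ℓ
  IsSqrt w r = NonNegative r × (∀ i → r i * r i ≈ w i)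

  sumSubsets : ∀ {n} → (Subset n → Carrier) → Carrier
  sumSubsets {zero}  f = f []
  sumSubsets {suc n} f =
    sumSubsets (λ S → f (outside ∷ S)) + sumSubsets (λ S → f (inside ∷ S))

  -- The least natural number that is at least x; this is ⌈ x ⌉ only if x > -1,
  -- which suffices for χ_f ≥ 0.
  IsCeiling : Carrier → Pred ℕ 0ℓ
  IsCeiling x = IsMinimum ℕ._≤_ (λ c → x ≤ c · 1#)

  module _ {n} (G : SimpleGraph n) where

    open SimpleGraph G using (_~_)

    record IsEdgeSupported (Z : Matrix n) : Set where
      field
        symmetric : IsSymmetric Z
        vanishing : ∀ i j → ¬ i ~ j → Z i j ≈ 0#

    -- θ is the value ϑₖ(G;w), for 0 ≤ k ≤ n and w ≥ 0.
    IsTheta : ℕ → Vector Carrier n → Pred Carrier 0ℓ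
    IsTheta k w = IsMinimum _≤_ λ s →
      ∃[ r ] ∃[ Z ] ∃[ μ ]
        IsSqrt w r ×
        IsEdgeSupported Z ×
        IsSpectrum (λ i j → r i * r j + Z i j) μ ×
        s ≈ sumFirst k μ

    -- 1 ≤ k ≤ n and ϑₖ(G;w) ≥ wᵀ𝟏 for every w ≥ 0.
    ThetaDominates : Pred ℕ 0ℓ
    ThetaDominates k =
      1 ℕ.≤ k × k ℕ.≤ n ×
      (∀ w → NonNegative w → ∀ θ → IsTheta k w θ → sum w ≤ θ)

    -- The bound m ≤ n, which keeps the indices in range, does not affect the
    -- minimum: for m = n the left-hand side is the trace of Z, which is 0.
    SpectrallyBalanced : .{{_ : NonZero n}} → Pred ℕ 0ℓ
    SpectrallyBalanced m =
      1 ℕ.≤ m × m ℕ.≤ n ×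
      (∀ Z → IsEdgeSupported Z → ∀ μ → IsSpectrum Z μ →
         λ₁ μ + sumLast (m ℕ.∸ 1) μ ≤ 0#)

    -- h(G) = m
    IsH : .{{_ : NonZero n}} → Pred ℕ 0ℓ
    IsH = IsMinimum ℕ._≤_ SpectrallyBalanced

    -- Weights are indexed by all subsets and vanish off the cocliques.
    record IsFractionalColouring (y : Subset n → Carrier) : Set where
      field
        nonNegative : ∀ S → 0# ≤ y S
        cocliques   : ∀ S → ¬ Coclique G S → y S ≈ 0#
        covers      : ∀ v →
          sumSubsets (λ S → if does (v ∈? S) then y S else 0#) ≈ 1#

    IsFractionalChromaticNumber : Pred Carrier 0ℓ
    IsFractionalChromaticNumber = IsMinimum _≤_ λ s →
      ∃[ y ] IsFractionalColouring y × s ≈ sumSubsets y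

{-# OPTIONS --safe #-}
module Submission where

-- For any vector u, put X = Σ_S y_S u_S u_Sᵀ / |u_S|², where y is an optimal
-- fractional colouring and u_S the restriction of u to the coclique S. Then X
-- vanishes on the edges, tr X ≤ χ_f, uᵀ X u = |u|², and 0 ≼ X ≼ I by
-- Cauchy–Schwarz; adding a multiple of I - X makes the trace exactly ⌈χ_f⌉.
-- In an orthonormal eigenbasis of a symmetric M, the diagonal of X consists of
-- weights x_i ∈ [0,1] with Σ x_i = tr X and Σ μ_i x_i = ⟨M,X⟩, so ⟨M,X⟩ lies
-- between the sums of the ⌈χ_f⌉ smallest and largest eigenvalues.
--   For M = √w√wᵀ + Z and u = √w, ⟨M,X⟩ = Σ w bounds ϑ from below. For M = Z and
-- u a top eigenvector, ⟨Z,X⟩ = 0 and x₁ = 1; the remaining weights have sum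
-- ⌈χ_f⌉ - 1, whence λ₁ plus the ⌈χ_f⌉ - 1 smallest eigenvalues is at most 0.
--   The eigenbasis is split off one vector at a time: a root μ₀ of the
-- characteristic polynomial gives a kernel vector of μ₀ I - M, a Householder
-- reflection moves it to the first axis, and cancelling t - μ₀ gives the
-- characteristic polynomial of the remaining block.

open import Defs
open import Axiom.ExcludedMiddle using (ExcludedMiddle)
open import Level using (0ℓ)

open import Algebra.Bundles using (CommutativeRing; Semiring)
import Algebra.Definitions.RawSemiring as RawSemiringDefinitions
import Algebra.Properties.Ring
import Algebra.Properties.Semiring.Mult.TCOptimised
import Algebra.Properties.Semiring.Sum
import Algebra.Solver.Ring
open import Algebra.Solver.Ring.AlmostCommutativeRing using (fromCommutativeRing; _-Raw-AlmostCommutative⟶_)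
open import Data.Bool.Base using (true; false; if_then_else_)
open import Data.Fin.Base as Fin using (Fin; zero; suc; punchIn; punchOut; toℕ; opposite)
open import Data.Fin.Permutation using (reverse)
open import Data.Fin.Properties
  using (suc-injective; toℕ-fromℕ<; opposite-prop; punchIn-punchOut; punchInᵢ≢i; punchIn-injective)
  renaming (_≟_ to _≟ᶠ_)
open import Data.Fin.Subset using (Subset; inside; outside; _∈_; Nonempty)
open import Data.Fin.Subset.Properties using (_∈?_; nonempty?)
open import Data.Integer.Base as ℤ using (ℤ; +_; -[1+_])
import Data.Integer.Properties as ℤ
import Data.Maybe.Base as Maybe
open import Data.Nat.Base as ℕ using (ℕ; zero; suc; NonZero)
open import Data.Nat.Induction using (<-rec)
open import Data.Nat.Properties as ℕ using (_<?_)
open import Data.Product.Base using (∃-syntax; _×_; _,_; proj₁; proj₂)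
import Data.Sign.Base as Sign
open import Data.Sum.Base using (_⊎_; inj₁; inj₂)
import Data.Vec.Base as Vec
open import Data.Vec.Functional using (Vector; _∷_; tail; insertAt)
open import Data.Vec.Functional.Properties using (insertAt-lookup; insertAt-punchIn)
open import Function.Base using (_∘_)
open import Relation.Binary.PropositionalEquality.Core as ≡ using (_≡_; _≢_)
import Relation.Binary.Reasoning.Setoid
open import Relation.Binary.Structures using (IsTotalOrder)
open import Relation.Nullary.Decidable.Core using (Dec; yes; no; does; dec⇒maybe)
open import Relation.Nullary.Negation.Core using (¬_; contradiction)

-- A spectrum comes as a bare list `μ` with det(tI - M) = ∏ (t - μ i) for all `t`, without
-- eigenvectors, and the partial sums refer to the order of that list. The weights must therefore be
-- attached to its entries in place: each step of the spectral theorem removes the head of the given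
-- list, and no basis is ever assembled. Three obstacles follow. Normalising an eigenvector takes a
-- square root, which completeness supplies. Invariance of det(tI - M) under reflections takes the
-- product rule for a determinant defined by expansion along the first row; it is derived from the
-- uniqueness of alternating functions. Cancelling t - μ₀ from an identity of functions says nothing
-- at t = μ₀, where a continuity argument steps in. The trace of X has to be the integer k itself:
-- eigenvalues have either sign, and the threshold terms in the comparison with k extreme
-- eigenvalues cancel only if Σ x_i = k. Raising the trace with I works only up to n, so ⌈χ_f⌉ ≤ n
-- has to be shown; it comes from a colouring from which the empty coclique has been removed.

module IntegerCoefficients {c ℓ} (R : CommutativeRing c ℓ) where
  open CommutativeRing R
  open Algebra.Properties.Ring ring
  open Algebra.Properties.Semiring.Mult.TCOptimised semiring renaming (_×_ to _·_)
  open Relation.Binary.Reasoning.Setoid setoid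

  -- The solver compares coefficients when it normalises, and equality in an abstract ring cannot be
  -- decided. Integers can be compared, and they map to every commutative ring.
  ⟦_⟧ℤ : ℤ → Carrier
  ⟦ ℤ.+ n ⟧ℤ    = n · 1#
  ⟦ -[1+ n ] ⟧ℤ = - (suc n · 1#)

  neg-homo : ∀ i → ⟦ ℤ.- i ⟧ℤ ≈ - ⟦ i ⟧ℤ
  neg-homo (ℤ.+ zero)  = sym -0#≈0#
  neg-homo (ℤ.+ suc n) = refl
  neg-homo -[1+ n ]    = sym (-‿involutive _)

  ⊖-homo : ∀ m n → ⟦ m ℤ.⊖ n ⟧ℤ ≈ m · 1# - n · 1#
  ⊖-homo m zero = begin
    m · 1#          ≈⟨ +-identityʳ _ ⟨
    m · 1# + 0#     ≈⟨ +-congˡ -0#≈0# ⟨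
    m · 1# - 0#     ∎
  ⊖-homo zero (suc n) = sym (+-identityˡ _)
  ⊖-homo (suc m) (suc n) = begin
    ⟦ suc m ℤ.⊖ suc n ⟧ℤ                ≡⟨ ≡.cong ⟦_⟧ℤ (ℤ.[1+m]⊖[1+n]≡m⊖n m n) ⟩
    ⟦ m ℤ.⊖ n ⟧ℤ                        ≈⟨ ⊖-homo m n ⟩
    m · 1# - n · 1#                     ≈⟨ +-congʳ (+-identityʳ _) ⟨
    m · 1# + 0# - n · 1#                ≈⟨ +-congʳ (+-congˡ (-‿inverseʳ 1#)) ⟨
    m · 1# + (1# - 1#) - n · 1#         ≈⟨ +-congʳ (+-assoc _ _ _) ⟨
    m · 1# + 1# - 1# - n · 1#           ≈⟨ +-assoc _ _ _ ⟩
    m · 1# + 1# + (- 1# - n · 1#)       ≈⟨ +-cong (+-comm _ _) (-‿+-comm _ _) ⟩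
    1# + m · 1# - (1# + n · 1#)         ≈⟨ +-cong (1+× m 1#) (-‿cong (1+× n 1#)) ⟨
    suc m · 1# - suc n · 1#             ∎

  +-homo : ∀ i j → ⟦ i ℤ.+ j ⟧ℤ ≈ ⟦ i ⟧ℤ + ⟦ j ⟧ℤ
  +-homo (ℤ.+ m) (ℤ.+ n) = ×-homo-+ 1# m n
  +-homo (ℤ.+ m) -[1+ n ] = ⊖-homo m (suc n)
  +-homo -[1+ m ] (ℤ.+ n) = trans (⊖-homo n (suc m)) (+-comm _ _)
  +-homo -[1+ m ] -[1+ n ] = begin
    - (suc (suc (m ℕ.+ n)) · 1#)        ≡⟨ ≡.cong (λ k → - (k · 1#)) (≡.cong suc (ℕ.+-suc m n)) ⟨
    - ((suc m ℕ.+ suc n) · 1#)          ≈⟨ -‿cong (×-homo-+ 1# (suc m) (suc n)) ⟩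
    - (suc m · 1# + suc n · 1#)         ≈⟨ -‿+-comm _ _ ⟨
    - (suc m · 1#) - suc n · 1#         ∎

  *-homo : ∀ i j → ⟦ i ℤ.* j ⟧ℤ ≈ ⟦ i ⟧ℤ * ⟦ j ⟧ℤ
  *-homo (ℤ.+ m) (ℤ.+ n) = begin
    ⟦ Sign.+ ℤ.◃ m ℕ.* n ⟧ℤ  ≡⟨ ≡.cong ⟦_⟧ℤ (ℤ.+◃n≡+n (m ℕ.* n)) ⟩
    (m ℕ.* n) · 1#            ≈⟨ ×1-homo-* m n ⟩
    m · 1# * (n · 1#)         ∎
  *-homo (ℤ.+ m) -[1+ n ] = begin
    ⟦ Sign.- ℤ.◃ m ℕ.* suc n ⟧ℤ  ≡⟨ ≡.cong ⟦_⟧ℤ (ℤ.-◃n≡-n (m ℕ.* suc n)) ⟩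
    ⟦ ℤ.- (ℤ.+ (m ℕ.* suc n)) ⟧ℤ ≈⟨ neg-homo (ℤ.+ (m ℕ.* suc n)) ⟩
    - ((m ℕ.* suc n) · 1#)        ≈⟨ -‿cong (×1-homo-* m (suc n)) ⟩
    - (m · 1# * (suc n · 1#))     ≈⟨ -‿distribʳ-* _ _ ⟩
    m · 1# * - (suc n · 1#)       ∎
  *-homo -[1+ m ] (ℤ.+ n) = begin
    ⟦ Sign.- ℤ.◃ suc m ℕ.* n ⟧ℤ  ≡⟨ ≡.cong ⟦_⟧ℤ (ℤ.-◃n≡-n (suc m ℕ.* n)) ⟩
    ⟦ ℤ.- (ℤ.+ (suc m ℕ.* n)) ⟧ℤ ≈⟨ neg-homo (ℤ.+ (suc m ℕ.* n)) ⟩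
    - ((suc m ℕ.* n) · 1#)        ≈⟨ -‿cong (×1-homo-* (suc m) n) ⟩
    - (suc m · 1# * (n · 1#))     ≈⟨ -‿distribˡ-* _ _ ⟩
    - (suc m · 1#) * (n · 1#)     ∎
  *-homo -[1+ m ] -[1+ n ] = begin
    (suc m ℕ.* suc n) · 1#              ≈⟨ ×1-homo-* (suc m) (suc n) ⟩
    suc m · 1# * (suc n · 1#)           ≈⟨ -‿involutive _ ⟨
    - - (suc m · 1# * (suc n · 1#))     ≈⟨ -‿cong (-‿distribˡ-* _ _) ⟩
    - (- (suc m · 1#) * (suc n · 1#))   ≈⟨ -‿distribʳ-* _ _ ⟩
    - (suc m · 1#) * - (suc n · 1#)     ∎

  morphism : ℤ.+-*-rawRing -Raw-AlmostCommutative⟶ fromCommutativeRing R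
  morphism = record
    { ⟦_⟧ = ⟦_⟧ℤ ; +-homo = +-homo ; *-homo = *-homo ; -‿homo = neg-homo
    ; 0-homo = refl ; 1-homo = refl }

  open Algebra.Solver.Ring ℤ.+-*-rawRing (fromCommutativeRing R) morphism
    (λ i j → Maybe.map (λ eq → reflexive (≡.cong ⟦_⟧ℤ eq)) (dec⇒maybe (i ℤ.≟ j)))
    public using (solve; _:=_; _:+_; _:*_; _:-_; :-_; con)

module Development (em : ExcludedMiddle 0ℓ) (ℝ : Reals) where

  open Reals ℝ
  open Over ℝ
  open RawSemiringDefinitions (Semiring.rawSemiring semiring) using (product) renaming (_×_ to _·_)
  open CommutativeRing commutativeRing using
    ( refl; sym; trans; reflexive; setoid; ring
    ; +-cong; +-congˡ; +-congʳ; +-assoc; +-identityˡ; +-identityʳ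
    ; *-cong; *-congˡ; *-congʳ; *-assoc; *-comm; *-identityˡ; *-identityʳ
    ; -‿cong; -‿inverseʳ; zeroˡ; zeroʳ; distribˡ)
  open Algebra.Properties.Ring ring using (-0#≈0#; -‿involutive)
  open Algebra.Properties.Semiring.Sum semiring using
    (sum; sum-cong-≋; sum-remove; sum-permute; sum-replicate; ∑-distrib-+; ∑-comm; *-distribˡ-sum; *-distribʳ-sum; sum-replicate-zero)
  open IsTotalOrder isTotalOrder using (total; antisym)
    renaming (refl to ≤-refl; reflexive to ≤-reflexive; trans to ≤-trans)
  open IntegerCoefficients commutativeRing using (solve; _:=_; _:+_; _:*_; _:-_; :-_; con)

  -- Ordered fields

  module ≈-Reasoning = Relation.Binary.Reasoning.Setoid setoid

  ≤-resp-≈ : ∀ {x x′ y y′} → x ≈ x′ → y ≈ y′ → x ≤ y → x′ ≤ y′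
  ≤-resp-≈ x≈x′ y≈y′ x≤y = ≤-trans (≤-reflexive (sym x≈x′)) (≤-trans x≤y (≤-reflexive y≈y′))

  0≤y-x⇒x≤y : ∀ {x y} → 0# ≤ y - x → x ≤ y
  0≤y-x⇒x≤y {x} {y} 0≤y-x = ≤-resp-≈ (+-identityˡ x)
    (solve 2 (λ x y → y :- x :+ x := y) refl x y) (+-monoˡ-≤ x 0≤y-x)

  x≤y⇒0≤y-x : ∀ {x y} → x ≤ y → 0# ≤ y - x
  x≤y⇒0≤y-x {x} x≤y = ≤-resp-≈ (-‿inverseʳ x) refl (+-monoˡ-≤ (- x) x≤y)

  ≤-by : ∀ {x y d} → y - x ≈ d → 0# ≤ d → x ≤ y
  ≤-by y-x≈d 0≤d = 0≤y-x⇒x≤y (≤-resp-≈ refl (sym y-x≈d) 0≤d)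

  +-nonNegative : ∀ {x y} → 0# ≤ x → 0# ≤ y → 0# ≤ x + y
  +-nonNegative {x} {y} 0≤x 0≤y =
    ≤-trans 0≤y (≤-by (solve 2 (λ x y → x :+ y :- y := x) refl x y) 0≤x)

  +-mono-≤ : ∀ {x y u v} → x ≤ y → u ≤ v → x + u ≤ y + v
  +-mono-≤ {x} {y} {u} {v} x≤y u≤v = ≤-by
    (solve 4 (λ x y u v → y :+ v :- (x :+ u) := y :- x :+ (v :- u)) refl x y u v)
    (+-nonNegative (x≤y⇒0≤y-x x≤y) (x≤y⇒0≤y-x u≤v))

  *-monoˡ-≤ : ∀ {x y z} → 0# ≤ x → y ≤ z → x * y ≤ x * z
  *-monoˡ-≤ {x} {y} {z} 0≤x y≤z = ≤-by
    (solve 3 (λ x y z → x :* z :- x :* y := x :* (z :- y)) refl x y z)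
    (*-nonNegative 0≤x (x≤y⇒0≤y-x y≤z))

  x≤0⇒0≤-x : ∀ {x} → x ≤ 0# → 0# ≤ - x
  x≤0⇒0≤-x {x} x≤0 = ≤-resp-≈ refl (+-identityˡ (- x)) (x≤y⇒0≤y-x x≤0)

  neg-antimono-≤ : ∀ {x y} → x ≤ y → - y ≤ - x
  neg-antimono-≤ {x} {y} x≤y = ≤-by
    (solve 2 (λ x y → :- x :- (:- y) := y :- x) refl x y) (x≤y⇒0≤y-x x≤y)

  square-nonNegative : ∀ x → 0# ≤ x * x
  square-nonNegative x with total 0# x
  ... | inj₁ 0≤x = *-nonNegative 0≤x 0≤x
  ... | inj₂ x≤0 = ≤-resp-≈ refl (solve 1 (λ x → (:- x) :* (:- x) := x :* x) refl x)
    (*-nonNegative (x≤0⇒0≤-x x≤0) (x≤0⇒0≤-x x≤0))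

  0≤1 : 0# ≤ 1#
  0≤1 = ≤-resp-≈ refl (*-identityˡ 1#) (square-nonNegative 1#)

  1≰0 : ¬ 1# ≤ 0#
  1≰0 1≤0 = 0≉1 (antisym 0≤1 1≤0)

  1≤q⇒q≉0 : ∀ {q} → 1# ≤ q → ¬ q ≈ 0#
  1≤q⇒q≉0 1≤q q≈0 = 1≰0 (≤-resp-≈ refl q≈0 1≤q)

  2≉0 : ¬ 1# + 1# ≈ 0#
  2≉0 = 1≤q⇒q≉0 (≤-by (solve 0 (con (+ 1) :+ con (+ 1) :- con (+ 1) := con (+ 1)) refl) 0≤1)

  *-cancelˡ-0 : ∀ {x y} → ¬ x ≈ 0# → x * y ≈ 0# → y ≈ 0#
  *-cancelˡ-0 {x} {y} x≉0 xy≈0 = begin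
    y              ≈⟨ *-identityˡ y ⟨
    1# * y         ≈⟨ *-congʳ xz≈1 ⟨
    x * z * y      ≈⟨ solve 3 (λ x y z → x :* z :* y := z :* (x :* y)) refl x y z ⟩
    z * (x * y)    ≈⟨ *-congˡ xy≈0 ⟩
    z * 0#         ≈⟨ zeroʳ z ⟩
    0#             ∎
    where
    open ≈-Reasoning
    z = proj₁ (inverse x x≉0)
    xz≈1 = proj₂ (inverse x x≉0)

  x-y≈0⇒x≈y : ∀ {x y} → x - y ≈ 0# → x ≈ y
  x-y≈0⇒x≈y {x} {y} eq = trans (solve 2 (λ x y → x := x :- y :+ y) refl x y)
    (trans (+-congʳ eq) (+-identityˡ y))

  x≈y⇒x-y≈0 : ∀ {x y} → x ≈ y → x - y ≈ 0#
  x≈y⇒x-y≈0 {x} {y} eq = trans (+-congʳ eq) (-‿inverseʳ y)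

  *-cancelˡ : ∀ {x y z} → ¬ x ≈ 0# → x * y ≈ x * z → y ≈ z
  *-cancelˡ {x} {y} {z} x≉0 eq = x-y≈0⇒x≈y (*-cancelˡ-0 x≉0
    (trans (solve 3 (λ x y z → x :* (y :- z) := x :* y :- x :* z) refl x y z) (x≈y⇒x-y≈0 eq)))

  square≈0⇒≈0 : ∀ {x} → x * x ≈ 0# → x ≈ 0#
  square≈0⇒≈0 {x} x²≈0 with em {x ≈ 0#}
  ... | yes x≈0 = x≈0
  ... | no  x≉0 = *-cancelˡ-0 x≉0 x²≈0

  -- A total inverse with value 0 at 0, so that a coclique on which `u` vanishes contributes nothing
  -- to the colour average. The two identities below are the laws of a pseudo-inverse and hold at 0
  -- as well.
  inv₀ : Carrier → Carrier
  inv₀ x with em {x ≈ 0#}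
  ... | yes _   = 0#
  ... | no  x≉0 = proj₁ (inverse x x≉0)

  inv₀-x-x : ∀ x → inv₀ x * x * x ≈ x
  inv₀-x-x x with em {x ≈ 0#}
  ... | yes x≈0 = trans (*-congˡ x≈0) (trans (zeroʳ _) (sym x≈0))
  ... | no  x≉0 = trans (*-congʳ (trans (*-comm _ _) (proj₂ (inverse x x≉0)))) (*-identityˡ x)

  inv₀-inv₀-x : ∀ x → inv₀ x * inv₀ x * x ≈ inv₀ x
  inv₀-inv₀-x x with em {x ≈ 0#}
  ... | yes x≈0 = trans (*-congˡ x≈0) (zeroʳ _)
  ... | no  x≉0 = trans (*-assoc _ _ _) (trans (*-congˡ (trans (*-comm _ _) (proj₂ (inverse x x≉0)))) (*-identityʳ _))

  inv₀-x≤1 : ∀ x → inv₀ x * x ≤ 1#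
  inv₀-x≤1 x with em {x ≈ 0#}
  ... | yes x≈0 = ≤-resp-≈ (sym (zeroˡ x)) refl 0≤1
  ... | no  x≉0 = ≤-reflexive (trans (*-comm _ _) (proj₂ (inverse x x≉0)))

  inv₀-nonNegative : ∀ {x} → 0# ≤ x → 0# ≤ inv₀ x
  inv₀-nonNegative {x} 0≤x = ≤-resp-≈ refl (inv₀-inv₀-x x)
    (*-nonNegative (square-nonNegative (inv₀ x)) 0≤x)

  inv₀-inverse : ∀ {x} → ¬ x ≈ 0# → inv₀ x * x ≈ 1#
  inv₀-inverse {x} x≉0 = *-cancelˡ x≉0
    (trans (*-comm _ _) (trans (inv₀-x-x x) (sym (*-identityʳ x))))

  -- If y ≤ x instead, then -(x - y)² = (y² - x²) + 2y(x - y) is non-negative, which forces x = y.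
  square-cancel-≤ : ∀ {x y} → 0# ≤ y → x * x ≤ y * y → x ≤ y
  square-cancel-≤ {x} {y} 0≤y x²≤y² with total x y
  ... | inj₁ x≤y = x≤y
  ... | inj₂ y≤x = ≤-reflexive (x-y≈0⇒x≈y (square≈0⇒≈0 (antisym
    (≤-by (solve 2 (λ x y → con (+ 0) :- (x :- y) :* (x :- y)
                          := y :* y :- x :* x :+ (y :* (x :- y) :+ y :* (x :- y))) refl x y)
      (+-nonNegative (x≤y⇒0≤y-x x²≤y²) (+-nonNegative 0≤y[x-y] 0≤y[x-y])))
    (square-nonNegative _))))
    where
    0≤y[x-y] = *-nonNegative 0≤y (x≤y⇒0≤y-x y≤x)

  *-cancelˡ-nonNegative : ∀ {x y} → 0# ≤ x → ¬ x ≈ 0# → 0# ≤ x * y → 0# ≤ y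
  *-cancelˡ-nonNegative {x} {y} 0≤x x≉0 0≤xy = ≤-resp-≈ refl
    (trans (sym (*-assoc _ _ _)) (trans (*-congʳ (inv₀-inverse x≉0)) (*-identityˡ y)))
    (*-nonNegative (inv₀-nonNegative 0≤x) 0≤xy)

  -- The supremum of the numbers with square at most `a`; this is where completeness enters. Each
  -- inequality follows by moving the supremum by some `ε` and concluding `ε ≤ 0`.
  sqrt : ∀ {a} → 0# ≤ a → ∃[ s ] s * s ≈ a
  sqrt {a} 0≤a = s , antisym s²≤a a≤s²
    where
    S : Carrier → Set
    S x = x * x ≤ a
    0∈S : S 0#
    0∈S = ≤-resp-≈ (sym (zeroˡ 0#)) refl 0≤a
    bound : ∀ x → S x → x ≤ a + 1#
    bound x x²≤a with total x 0#
    ... | inj₁ x≤0 = ≤-trans x≤0 (+-nonNegative 0≤a 0≤1)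
    ... | inj₂ 0≤x = ≤-by
      (solve 2 (λ a x → a :+ con (+ 1) :- x
         := a :- x :* x :+ (x :- con (+ 1)) :* (x :- con (+ 1)) :+ x) refl a x)
      (+-nonNegative (+-nonNegative (x≤y⇒0≤y-x x²≤a) (square-nonNegative _)) 0≤x)
    lub = supremum S (0# , 0∈S) (a + 1# , bound)
    s = proj₁ lub
    upper : ∀ x → S x → x ≤ s
    upper = proj₁ (proj₂ lub)
    least : ∀ u → UpperBound S u → s ≤ u
    least = proj₂ (proj₂ lub)
    0≤s : 0# ≤ s
    0≤s = upper 0# 0∈S
    -- For 0 ≤ ε ≤ 1 the square grows from `s` to `s + ε` by (2s + ε)ε ≤ qε. The summand 1 also
    -- keeps `q` invertible when `s` is 0.
    q = s + s + 1#
    1≤q : 1# ≤ q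
    1≤q = ≤-by (solve 1 (λ s → s :+ s :+ con (+ 1) :- con (+ 1) := s :+ s) refl s) (+-nonNegative 0≤s 0≤s)

    divide : ∀ {p} d → 1# ≤ p → ∃[ ε ] p * ε ≈ d × (∀ {x y} → p * y ≈ x → 0# ≤ x → 0# ≤ y)
    divide {p} d 1≤p = inv₀ p * d ,
      trans (sym (*-assoc _ _ _)) (trans (*-congʳ (trans (*-comm _ _) (inv₀-inverse p≉0))) (*-identityˡ d)) ,
      λ eq 0≤x → *-cancelˡ-nonNegative (≤-trans 0≤1 1≤p) p≉0 (≤-resp-≈ refl (sym eq) 0≤x)
      where p≉0 = 1≤q⇒q≉0 1≤p

    -- s + ε with ε = (a - s²) / (a - s² + 2s + 1) still has square at most a.
    a≤s² : a ≤ s * s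
    a≤s² with total a (s * s)
    ... | inj₁ a≤s² = a≤s²
    ... | inj₂ s²≤a = ≤-by s²-a≈-pε (*-nonNegative 0≤p (x≤0⇒0≤-x ε≤0))
      where
      d = a - s * s
      0≤d = x≤y⇒0≤y-x s²≤a
      p = d + q
      1≤p : 1# ≤ p
      1≤p = ≤-trans 1≤q (≤-by (solve 2 (λ d e → d :+ e :- e := d) refl d q) 0≤d)
      0≤p = ≤-trans 0≤1 1≤p
      quot = divide d 1≤p
      ε = proj₁ quot
      pε≈d = proj₁ (proj₂ quot)
      0≤ε = proj₂ (proj₂ quot) pε≈d 0≤d
      0≤1-ε : 0# ≤ 1# - ε
      0≤1-ε = proj₂ (proj₂ quot) (trans
        (solve 2 (λ p ε → p :* (con (+ 1) :- ε) := p :- p :* ε) refl p ε)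
        (trans (+-congˡ (-‿cong pε≈d)) (solve 2 (λ d q → d :+ q :- d := q) refl d q)))
        (≤-trans 0≤1 1≤q)
      gap : a - (s + ε) * (s + ε) ≈ ε * d + ε * (1# - ε)
      gap = trans (solve 3 (λ a s ε → a :- (s :+ ε) :* (s :+ ε) := a :- s :* s :- (s :+ s :+ ε) :* ε) refl a s ε)
        (trans (+-congʳ (sym pε≈d)) (solve 3 (λ d s ε → (d :+ (s :+ s :+ con (+ 1))) :* ε :- (s :+ s :+ ε) :* ε
           := ε :* d :+ ε :* (con (+ 1) :- ε)) refl d s ε))
      ε≤0 : ε ≤ 0#
      ε≤0 = ≤-by (solve 2 (λ s ε → con (+ 0) :- ε := s :- (s :+ ε)) refl s ε) (x≤y⇒0≤y-x
        (upper (s + ε) (≤-by gap (+-nonNegative (*-nonNegative 0≤ε 0≤d) (*-nonNegative 0≤ε 0≤1-ε)))))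
      s²-a≈-pε : s * s - a ≈ p * (- ε)
      s²-a≈-pε = trans (solve 2 (λ a s → s :* s :- a := :- (a :- s :* s)) refl a s)
        (trans (-‿cong (sym pε≈d)) (solve 2 (λ p ε → :- (p :* ε) := p :* (:- ε)) refl p ε))

    -- s - ε with ε = (s² - a) / (2s + 1) is still an upper bound.
    s²≤a : s * s ≤ a
    s²≤a with total (s * s) a
    ... | inj₁ s²≤a = s²≤a
    ... | inj₂ a≤s² = ≤-by a-s²≈-qε (*-nonNegative (≤-trans 0≤1 1≤q) (x≤0⇒0≤-x ε≤0))
      where
      d = s * s - a
      0≤d = x≤y⇒0≤y-x a≤s²
      quot = divide d 1≤q
      ε = proj₁ quot
      qε≈d = proj₁ (proj₂ quot)
      0≤ε = proj₂ (proj₂ quot) qε≈d 0≤d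
      0≤s-ε : 0# ≤ s - ε
      0≤s-ε = proj₂ (proj₂ quot) (trans
        (solve 3 (λ q s ε → q :* (s :- ε) := q :* s :- q :* ε) refl q s ε)
        (trans (+-congˡ (-‿cong qε≈d))
          (solve 2 (λ a s → (s :+ s :+ con (+ 1)) :* s :- (s :* s :- a) := s :* s :+ s :+ a) refl a s)))
        (+-nonNegative (+-nonNegative (square-nonNegative s) 0≤s) 0≤a)
      gap : ∀ x → (s - ε) * (s - ε) - x * x ≈ a - x * x + ε + ε * ε
      gap x = trans
        (solve 4 (λ a s ε x → (s :- ε) :* (s :- ε) :- x :* x
           := s :* s :- a :- (s :+ s :+ con (+ 1)) :* ε :+ (a :- x :* x :+ ε :+ ε :* ε)) refl a s ε x)
        (trans (+-congʳ (x≈y⇒x-y≈0 (sym qε≈d))) (+-identityˡ _))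
      ε≤0 : ε ≤ 0#
      ε≤0 = ≤-by (solve 2 (λ s ε → con (+ 0) :- ε := s :- ε :- s) refl s ε) (x≤y⇒0≤y-x
        (least (s - ε) λ x x²≤a → square-cancel-≤ 0≤s-ε (≤-by (gap x)
          (+-nonNegative (+-nonNegative (x≤y⇒0≤y-x x²≤a) 0≤ε) (square-nonNegative ε)))))
      a-s²≈-qε : a - s * s ≈ q * (- ε)
      a-s²≈-qε = trans (solve 2 (λ a s → a :- s :* s := :- (s :* s :- a)) refl a s)
        (trans (-‿cong (sym qε≈d)) (solve 2 (λ p ε → :- (p :* ε) := p :* (:- ε)) refl q ε))

  -- Determinants

  sum-zero : ∀ {n} {f : Vector Carrier n} → (∀ i → f i ≈ 0#) → sum f ≈ 0#
  sum-zero {n} f≈0 = trans (sum-cong-≋ f≈0) (sum-replicate-zero n)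

  sum-single : ∀ {n} (f : Vector Carrier n) j → (∀ i → i ≢ j → f i ≈ 0#) → sum f ≈ f j
  sum-single {suc n} f j f≈0 = trans (sum-remove {i = j} f)
    (trans (+-congˡ (sum-zero λ i → f≈0 (punchIn j i) (punchInᵢ≢i j i))) (+-identityʳ _))

  sum-linear : ∀ {n} a b (f g : Vector Carrier n) →
               sum (λ i → a * f i + b * g i) ≈ a * sum f + b * sum g
  sum-linear a b f g = trans (∑-distrib-+ (λ i → a * f i) (λ i → b * g i))
    (sym (+-cong (*-distribˡ-sum a f) (*-distribˡ-sum b g)))

  scalar-diagonal : ∀ {n} t (i : Fin n) → scalar t i i ≈ t
  scalar-diagonal t i with i ≟ᶠ i
  ... | yes _  = refl
  ... | no i≢i = contradiction ≡.refl i≢i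

  scalar-off-diagonal : ∀ {n} t {i j : Fin n} → i ≢ j → scalar t i j ≈ 0#
  scalar-off-diagonal t {i} {j} i≢j with i ≟ᶠ j
  ... | yes i≡j = contradiction i≡j i≢j
  ... | no _    = refl

  -- Rectangular, because fixing the first row of a function of matrices leaves a function of fewer
  -- rows of the same length.
  Rows : ℕ → ℕ → Set
  Rows n m = Fin n → Vector Carrier m

  𝟙 : ∀ {n} → Matrix n
  𝟙 = scalar 1#

  infix 4 _≋_
  _≋_ : ∀ {m} → Vector Carrier m → Vector Carrier m → Set
  u ≋ v = ∀ j → u j ≈ v j

  AgreeExcept : ∀ {n m} → Fin n → Rows n m → Rows n m → Set
  AgreeExcept i A B = ∀ k → k ≢ i → A k ≋ B k

  -- Linearity in row `i` relates three arrays that agree elsewhere up to `≈`; this form avoids an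
  -- operation that replaces one row.
  record IsMultilinear {n m} (D : Rows n m → Carrier) : Set where
    field
      cong   : ∀ {A B} → (∀ i → A i ≋ B i) → D A ≈ D B
      linear : ∀ i a b {A B C} → (∀ j → A i j ≈ a * B i j + b * C i j) →
               AgreeExcept i A B → AgreeExcept i A C → D A ≈ a * D B + b * D C

  record IsAlternating {n m} (D : Rows n m → Carrier) : Set where
    field
      isMultilinear : IsMultilinear D
      alternating   : ∀ {A} i k → i ≢ k → A i ≋ A k → D A ≈ 0#
    open IsMultilinear isMultilinear public

  tail-multilinear : ∀ {n m} {D : Rows (suc n) m → Carrier} → IsMultilinear D →
                     ∀ r → IsMultilinear (λ B → D (r ∷ B))
  tail-multilinear {D = D} D-lin r = record
    { cong   = λ A≋B → cong λ { zero j → refl ; (suc i) → A≋B i }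
    ; linear = λ i a b A≈ A~B A~C → linear (suc i) a b A≈
        (λ { zero _ j → refl ; (suc k) k≢i → A~B k (k≢i ∘ ≡.cong suc) })
        (λ { zero _ j → refl ; (suc k) k≢i → A~C k (k≢i ∘ ≡.cong suc) })
    }
    where open IsMultilinear D-lin

  tail-alternating : ∀ {n m} {D : Rows (suc n) m → Carrier} → IsAlternating D →
                     ∀ r → IsAlternating (λ B → D (r ∷ B))
  tail-alternating D-alt r = record
    { isMultilinear = tail-multilinear isMultilinear r
    ; alternating   = λ i k i≢k → alternating (suc i) (suc k) (i≢k ∘ suc-injective)
    }
    where open IsAlternating D-alt

  ∷-linear : ∀ {n m} {D : Rows (suc n) m → Carrier} → IsMultilinear D →
             ∀ a b {u v w} {B : Rows n m} → (∀ j → u j ≈ a * v j + b * w j) →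
             D (u ∷ B) ≈ a * D (v ∷ B) + b * D (w ∷ B)
  ∷-linear D-lin a b u≈ = IsMultilinear.linear D-lin zero a b u≈
    (λ { zero z≢z → contradiction ≡.refl z≢z ; (suc k) _ j → refl })
    (λ { zero z≢z → contradiction ≡.refl z≢z ; (suc k) _ j → refl })

  ∷-cong : ∀ {n m} {D : Rows (suc n) m → Carrier} → IsMultilinear D →
           ∀ {A : Rows (suc n) m} {u B} → A zero ≋ u → (∀ i → A (suc i) ≋ B i) → D A ≈ D (u ∷ B)
  ∷-cong D-lin A₀≋u A₊≋B = IsMultilinear.cong D-lin λ { zero → A₀≋u ; (suc i) → A₊≋B i }

  -- Expanding one row at a time, the part proportional to `r` dies by hypothesis. In the
  -- applications `E` is an alternating function whose first row is fixed to `r`, so this is the row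
  -- operation that adds multiples of that row to the others.
  clear-rows : ∀ {n m} {E : Rows n m → Carrier} → IsMultilinear E →
               ∀ r → (∀ B i → B i ≋ r → E B ≈ 0#) →
               ∀ (c : Vector Carrier n) B → E (λ i j → B i j + c i * r j) ≈ E B
  clear-rows {zero}  E-lin r E≈0 c B = IsMultilinear.cong E-lin λ ()
  clear-rows {suc n} {E = E} E-lin r E≈0 c B = begin
    E (λ i j → B i j + c i * r j)                 ≈⟨ ∷-cong E-lin (λ j → refl) (λ i j → refl) ⟩
    E (b′ ∷ B′)                                   ≈⟨ ∷-linear E-lin 1# (c zero) (λ j → +-congʳ (sym (*-identityˡ _))) ⟩
    1# * E (B zero ∷ B′) + c zero * E (r ∷ B′)    ≈⟨ +-cong (*-identityˡ _) (trans (*-congˡ (E≈0 _ zero (λ j → refl))) (zeroʳ _)) ⟩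
    E (B zero ∷ B′) + 0#                          ≈⟨ +-identityʳ _ ⟩
    E (B zero ∷ B′)                               ≈⟨ clear-rows (tail-multilinear E-lin (B zero)) r
                                                       (λ C i → E≈0 (B zero ∷ C) (suc i)) (tail c) (tail B) ⟩
    E (B zero ∷ tail B)                           ≈⟨ ∷-cong E-lin (λ j → refl) (λ i j → refl) ⟨
    E B                                           ∎
    where
    open ≈-Reasoning
    b′ = λ j → B zero j + c zero * r j
    B′ = λ i j → B (suc i) j + c (suc i) * r j

  -- Polarisation: expand the value 0 at the rows (u + v, u + v); the terms with two equal rows
  -- vanish.
  swap-rows : ∀ {n m} {D : Rows (suc (suc n)) m → Carrier} → IsMultilinear D →
              (∀ {A} → A zero ≋ A (suc zero) → D A ≈ 0#) →
              ∀ u v B → D (u ∷ v ∷ B) ≈ - D (v ∷ u ∷ B)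
  swap-rows {D = D} D-lin D≈0 u v B = x-y≈0⇒x≈y (begin
    D (u ∷ v ∷ B) - - D (v ∷ u ∷ B)
      ≈⟨ solve 2 (λ x y → x :- (:- y) := con (+ 1) :* (con (+ 1) :* con (+ 0) :+ con (+ 1) :* x) :+ con (+ 1) :* (con (+ 1) :* y :+ con (+ 1) :* con (+ 0))) refl _ _ ⟩
    1# * (1# * 0# + 1# * D (u ∷ v ∷ B)) + 1# * (1# * D (v ∷ u ∷ B) + 1# * 0#)
      ≈⟨ +-cong (*-congˡ (+-congʳ (*-congˡ (D≈0 λ j → refl)))) (*-congˡ (+-congˡ (*-congˡ (D≈0 λ j → refl)))) ⟨
    1# * (1# * D (u ∷ u ∷ B) + 1# * D (u ∷ v ∷ B)) + 1# * (1# * D (v ∷ u ∷ B) + 1# * D (v ∷ v ∷ B))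
      ≈⟨ +-cong (*-congˡ (∷-linear (tail-multilinear D-lin u) 1# 1# λ j → refl))
                (*-congˡ (∷-linear (tail-multilinear D-lin v) 1# 1# λ j → refl)) ⟨
    1# * D (u ∷ w ∷ B) + 1# * D (v ∷ w ∷ B)
      ≈⟨ ∷-linear D-lin 1# 1# (λ j → refl) ⟨
    D (w ∷ w ∷ B)
      ≈⟨ D≈0 (λ j → refl) ⟩
    0# ∎)
    where
    open ≈-Reasoning
    w = λ j → 1# * u j + 1# * v j

  -- The hypothesis `eq` is the induction hypothesis of `front-row` with row 0 held fixed; one more
  -- swap carries row `j + 1` past row 0.
  front-row-step : ∀ {n m} {D : Rows (suc (suc n)) m → Carrier} → IsMultilinear D →
                   (∀ {A} → A zero ≋ A (suc zero) → D A ≈ 0#) → ∀ R j →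
                   D (R zero ∷ R (suc j) ∷ λ i → R (suc (punchIn j i))) ≈ [-1]^ (toℕ j) * D R →
                   D (R (suc j) ∷ λ i → R (punchIn (suc j) i)) ≈ [-1]^ (toℕ (suc j)) * D R
  front-row-step {D = D} D-lin D≈0 R j eq = begin
    D (R (suc j) ∷ λ i → R (punchIn (suc j) i))
      ≈⟨ ∷-cong D-lin (λ _ → refl) (λ { zero _ → refl ; (suc i) _ → refl }) ⟩
    D (R (suc j) ∷ R zero ∷ λ i → R (suc (punchIn j i)))
      ≈⟨ swap-rows D-lin D≈0 _ _ _ ⟩
    - D (R zero ∷ R (suc j) ∷ λ i → R (suc (punchIn j i)))
      ≈⟨ -‿cong eq ⟩
    - ([-1]^ (toℕ j) * D R)
      ≈⟨ solve 2 (λ s d → :- (s :* d) := (:- s) :* d) refl _ _ ⟩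
    - [-1]^ (toℕ j) * D R ∎
    where open ≈-Reasoning

  front-row : ∀ {n m} {D : Rows (suc n) m → Carrier} → IsAlternating D → ∀ R j →
              D (R j ∷ λ i → R (punchIn j i)) ≈ [-1]^ (toℕ j) * D R
  front-row D-alt R zero = trans (sym (∷-cong (IsAlternating.isMultilinear D-alt) (λ _ → refl) (λ _ _ → refl)))
    (sym (*-identityˡ _))
  front-row {suc n} D-alt R (suc j) = front-row-step isMultilinear (alternating zero (suc zero) λ ()) R j
    (trans (front-row (tail-alternating D-alt (R zero)) (tail R) j)
      (*-congˡ (sym (∷-cong isMultilinear (λ _ → refl) (λ _ _ → refl)))))
    where open IsAlternating D-alt

  minor : ∀ {n} → Matrix (suc n) → Fin (suc n) → Matrix n
  minor M j i l = M (suc i) (punchIn j l)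

  laplace : ∀ {n} → Matrix (suc n) → Fin (suc n) → Carrier
  laplace M j = [-1]^ (toℕ j) * M zero j * det (minor M j)

  det-cong : ∀ {n} {A B : Matrix n} → (∀ i → A i ≋ B i) → det A ≈ det B
  det-cong {zero}  A≋B = refl
  det-cong {suc n} A≋B = sum-cong-≋ λ j →
    *-cong (*-congˡ {[-1]^ (toℕ j)} (A≋B zero j)) (det-cong λ i l → A≋B (suc i) (punchIn j l))

  det-linear : ∀ {n} i a b {A B C : Matrix n} → (∀ j → A i j ≈ a * B i j + b * C i j) →
               AgreeExcept i A B → AgreeExcept i A C → det A ≈ a * det B + b * det C
  det-linear zero a b {A} {B} {C} A₀≈ A~B A~C = trans
    (sum-cong-≋ λ j → begin
      [-1]^ (toℕ j) * A zero j * det (minor A j)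
        ≈⟨ *-congʳ (*-congˡ {[-1]^ (toℕ j)} (A₀≈ j)) ⟩
      [-1]^ (toℕ j) * (a * B zero j + b * C zero j) * det (minor A j)
        ≈⟨ solve 6 (λ s a b x y d → s :* (a :* x :+ b :* y) :* d := a :* (s :* x :* d) :+ b :* (s :* y :* d)) refl
             ([-1]^ (toℕ j)) a b (B zero j) (C zero j) (det (minor A j)) ⟩
      a * ([-1]^ (toℕ j) * B zero j * det (minor A j)) + b * ([-1]^ (toℕ j) * C zero j * det (minor A j))
        ≈⟨ +-cong (*-congˡ (*-congˡ {[-1]^ (toℕ j) * B zero j} (det-cong λ i l → A~B (suc i) (λ ()) (punchIn j l))))
                  (*-congˡ (*-congˡ {[-1]^ (toℕ j) * C zero j} (det-cong λ i l → A~C (suc i) (λ ()) (punchIn j l)))) ⟩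
      a * laplace B j + b * laplace C j ∎)
    (sum-linear a b (laplace B) (laplace C))
    where open ≈-Reasoning
  det-linear (suc i) a b {A} {B} {C} Aᵢ≈ A~B A~C = trans
    (sum-cong-≋ λ j → begin
      [-1]^ (toℕ j) * A zero j * det (minor A j)
        ≈⟨ *-congˡ {[-1]^ (toℕ j) * A zero j} (det-linear i a b {B = minor B j} {C = minor C j} (λ l → Aᵢ≈ (punchIn j l))
             (λ k k≢i l → A~B (suc k) (k≢i ∘ suc-injective) (punchIn j l))
             (λ k k≢i l → A~C (suc k) (k≢i ∘ suc-injective) (punchIn j l))) ⟩
      [-1]^ (toℕ j) * A zero j * (a * det (minor B j) + b * det (minor C j))
        ≈⟨ solve 6 (λ s x a b d e → s :* x :* (a :* d :+ b :* e) := a :* (s :* x :* d) :+ b :* (s :* x :* e)) refl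
             ([-1]^ (toℕ j)) (A zero j) a b (det (minor B j)) (det (minor C j)) ⟩
      a * ([-1]^ (toℕ j) * A zero j * det (minor B j)) + b * ([-1]^ (toℕ j) * A zero j * det (minor C j))
        ≈⟨ +-cong (*-congˡ (*-congʳ {det (minor B j)} (*-congˡ {[-1]^ (toℕ j)} (A~B zero (λ ()) j))))
                  (*-congˡ (*-congʳ {det (minor C j)} (*-congˡ {[-1]^ (toℕ j)} (A~C zero (λ ()) j)))) ⟩
      a * laplace B j + b * laplace C j ∎)
    (sum-linear a b (laplace B) (laplace C))
    where open ≈-Reasoning

  det-multilinear : ∀ {n} → IsMultilinear (det {n})
  det-multilinear = record { cong = det-cong ; linear = det-linear }

  -- The terms (0, l) and (suc l, 0) cancel; the others are the same sum without
  -- the first column.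
  double-laplace≈0 : ∀ {m} (a : Vector Carrier (suc (suc m))) (d : (Fin m → Fin (suc (suc m))) → Carrier) →
    (∀ {g h} → (∀ x → g x ≡ h x) → d g ≈ d h) →
    sum (λ j → [-1]^ (toℕ j) * a j *
      sum (λ l → [-1]^ (toℕ l) * a (punchIn j l) * d (λ x → punchIn j (punchIn l x)))) ≈ 0#
  double-laplace≈0 {m} a d d-cong = begin
    sum (λ j → [-1]^ (toℕ j) * a j * sum (λ l → G j l))
      ≈⟨ sum-cong-≋ (λ j → *-distribˡ-sum ([-1]^ (toℕ j) * a j) (G j)) ⟩
    sum (F zero) + sum (λ j → F (suc j) zero + sum (λ l → F (suc j) (suc l)))
      ≈⟨ +-congˡ (∑-distrib-+ (λ j → F (suc j) zero) (λ j → sum (λ l → F (suc j) (suc l)))) ⟩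
    sum (F zero) + (sum (λ j → F (suc j) zero) + rest)
      ≈⟨ +-assoc _ _ _ ⟨
    sum (F zero) + sum (λ j → F (suc j) zero) + rest
      ≈⟨ +-congʳ (∑-distrib-+ (F zero) (λ j → F (suc j) zero)) ⟨
    sum (λ j → F zero j + F (suc j) zero) + rest
      ≈⟨ +-cong (sum-zero λ j → solve 4 (λ s x y d → con (+ 1) :* x :* (s :* y :* d) :+ (:- s) :* y :* (con (+ 1) :* x :* d) := con (+ 0)) refl
                  ([-1]^ (toℕ j)) (a zero) (a (suc j)) (d (λ x → suc (punchIn j x))))
                (rest≈0 a d d-cong) ⟩
    0# + 0#
      ≈⟨ +-identityˡ 0# ⟩
    0# ∎
    where
    open ≈-Reasoning
    G : Fin (suc (suc m)) → Fin (suc m) → Carrier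
    G j l = [-1]^ (toℕ l) * a (punchIn j l) * d (λ x → punchIn j (punchIn l x))
    F : Fin (suc (suc m)) → Fin (suc m) → Carrier
    F j l = [-1]^ (toℕ j) * a j * G j l
    rest = sum (λ j → sum (λ l → F (suc j) (suc l)))
    -- Column 0 is never chosen in these terms, so it stays among the columns seen by `d`: the
    -- selection is `Fin.lift 1` of a selection from the other columns. The two extra signs cancel.
    rest≈0 : ∀ {m} (a : Vector Carrier (suc (suc m))) (d : (Fin m → Fin (suc (suc m))) → Carrier) →
      (∀ {g h} → (∀ x → g x ≡ h x) → d g ≈ d h) →
      sum {suc m} (λ j → sum {m} λ l → - [-1]^ (toℕ j) * a (suc j) *
        (- [-1]^ (toℕ l) * a (suc (punchIn j l)) * d (λ x → punchIn (suc j) (punchIn (suc l) x)))) ≈ 0#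
    rest≈0 {zero}  a d d-cong = +-identityˡ 0#
    rest≈0 {suc m} a d d-cong = trans
      (sum-cong-≋ λ j → trans
        (sum-cong-≋ λ l → trans
          (solve 5 (λ s x t y d → (:- s) :* x :* ((:- t) :* y :* d) := s :* x :* (t :* y :* d)) refl
            ([-1]^ (toℕ j)) (a (suc j)) ([-1]^ (toℕ l)) (a (suc (punchIn j l)))
            (d (λ x → punchIn (suc j) (punchIn (suc l) x))))
          (*-congˡ {[-1]^ (toℕ j) * a (suc j)} (*-congˡ {[-1]^ (toℕ l) * a (suc (punchIn j l))}
            (d-cong {h = Fin.lift 1 λ x → punchIn j (punchIn l x)} λ { zero → ≡.refl ; (suc x) → ≡.refl }))))
        (sym (*-distribˡ-sum {suc m} ([-1]^ (toℕ j) * a (suc j)) (λ l → [-1]^ (toℕ l) * a (suc (punchIn j l)) *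
          d (Fin.lift 1 λ x → punchIn j (punchIn l x))))))
      (double-laplace≈0 (tail a) (λ g → d (Fin.lift 1 g))
        (λ g≗h → d-cong λ { zero → ≡.refl ; (suc x) → ≡.cong suc (g≗h x) }))

  det-alternating-front : ∀ {n} {A : Matrix (suc (suc n))} → A zero ≋ A (suc zero) → det A ≈ 0#
  det-alternating-front {A = A} A₀≋A₁ = trans
    (sum-cong-≋ λ j → *-congˡ {[-1]^ (toℕ j) * A zero j} (sum-cong-≋ λ l →
      *-congʳ {det (minor (minor A j) l)} (*-congˡ {[-1]^ (toℕ l)} (sym (A₀≋A₁ (punchIn j l))))))
    (double-laplace≈0 (A zero) (λ g → det λ i x → A (suc (suc i)) (g x))
      (λ g≗h → det-cong λ i x → reflexive (≡.cong (A (suc (suc i))) (g≗h x))))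

  [-1]^*x≈0 : ∀ k {x} → [-1]^ k * x ≈ 0# → x ≈ 0#
  [-1]^*x≈0 zero    {x} eq = trans (sym (*-identityˡ x)) eq
  [-1]^*x≈0 (suc k) {x} eq = [-1]^*x≈0 k (trans
    (solve 2 (λ s x → s :* x := :- ((:- s) :* x)) refl _ x) (trans (-‿cong eq) -0#≈0#))

  det-alternating-tail : ∀ {n} → IsAlternating (det {n}) → ∀ {A : Matrix (suc n)} i k → i ≢ k →
                         A (suc i) ≋ A (suc k) → det A ≈ 0#
  det-alternating-tail det-alt {A} i k i≢k Aᵢ≋Aₖ = sum-zero λ j → trans
    (*-congˡ {[-1]^ (toℕ j) * A zero j} (IsAlternating.alternating det-alt {minor A j} i k i≢k (λ l → Aᵢ≋Aₖ (punchIn j l)))) (zeroʳ _)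

  -- Equal rows below the first are equal rows of every minor. If row 0 equals row `k + 1`, the
  -- latter is brought next to row 0 by `front-row`, applied to the function of the remaining rows,
  -- which is alternating by induction; the double expansion then vanishes.
  det-alternating : ∀ {n} → IsAlternating (det {n})
  det-alternating {zero}  = record { isMultilinear = det-multilinear ; alternating = λ () }
  det-alternating {suc n} = record { isMultilinear = det-multilinear ; alternating = alternating }
    where
    det-alt = det-alternating {n}
    front : ∀ {n} → IsAlternating (det {n}) → ∀ {A : Matrix (suc n)} k → A zero ≋ A (suc k) → det A ≈ 0#
    front {suc n} det-alt {A} k A₀≋Aₖ = [-1]^*x≈0 (toℕ k) (begin
      [-1]^ (toℕ k) * det A                            ≈⟨ *-congˡ (∷-cong (det-multilinear {suc (suc n)}) {A} (λ _ → refl) (λ _ _ → refl)) ⟩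
      [-1]^ (toℕ k) * det (A zero ∷ tail A)            ≈⟨ front-row E-alt (tail A) k ⟨
      det (A zero ∷ A (suc k) ∷ λ i → A (suc (punchIn k i)))  ≈⟨ det-alternating-front {A = A zero ∷ A (suc k) ∷ λ i → A (suc (punchIn k i))} A₀≋Aₖ ⟩
      0#                                               ∎)
      where
      open ≈-Reasoning
      E-alt : IsAlternating (λ B → det (A zero ∷ B))
      E-alt = record
        { isMultilinear = tail-multilinear det-multilinear (A zero)
        ; alternating   = λ {B} i k → det-alternating-tail det-alt {A zero ∷ B} i k }
    alternating : ∀ {A : Matrix (suc n)} i k → i ≢ k → A i ≋ A k → det A ≈ 0#
    alternating         zero    zero    0≢0 _  = contradiction ≡.refl 0≢0
    alternating {A = A} zero    (suc k) _   eq = front det-alt {A} k eq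
    alternating {A = A} (suc i) zero    _   eq = front det-alt {A} i (λ j → sym (eq j))
    alternating {A = A} (suc i) (suc k) i≢k eq = det-alternating-tail det-alt {A} i k (i≢k ∘ ≡.cong suc) eq

  -- Uniqueness of alternating functions, the product rule and singular matrices

  linear-expansion : ∀ {m} (f : Vector Carrier m → Carrier) → (∀ {u v} → u ≋ v → f u ≈ f v) →
                     (∀ a b {u v w} → (∀ j → u j ≈ a * v j + b * w j) → f u ≈ a * f v + b * f w) →
                     ∀ v → f v ≈ sum (λ j → v j * f (𝟙 j))
  linear-expansion {zero} f f-cong f-linear v = trans
    (f-linear 0# 0# {v = v} {w = v} (λ ())) (solve 1 (λ x → con (+ 0) :* x :+ con (+ 0) :* x := con (+ 0)) refl (f v))
  linear-expansion {suc m} f f-cong f-linear v = begin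
    f v                                                     ≈⟨ f-linear (v zero) 1# {w = 0# ∷ tail v} split ⟩
    v zero * f (𝟙 zero) + 1# * f (0# ∷ tail v)              ≈⟨ +-congˡ (trans (*-identityˡ _) (linear-expansion g
      (λ u≋v → f-cong λ { zero → refl ; (suc j) → u≋v j })
      (λ a b u≈ → f-linear a b λ { zero → solve 2 (λ a b → con (+ 0) := a :* con (+ 0) :+ b :* con (+ 0)) refl a b ; (suc j) → u≈ j })
      (tail v))) ⟩
    v zero * f (𝟙 zero) + sum (λ j → v (suc j) * g (𝟙 j))   ≈⟨ +-congˡ (sum-cong-≋ λ j → *-congˡ {v (suc j)}
      (f-cong {0# ∷ 𝟙 j} {𝟙 (suc j)} λ { zero → refl ; (suc l) → refl })) ⟩
    sum (λ j → v j * f (𝟙 j))                               ∎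
    where
    open ≈-Reasoning
    g : Vector Carrier m → Carrier
    g u = f (0# ∷ u)
    split : ∀ j → v j ≈ v zero * 𝟙 zero j + 1# * (0# ∷ tail v) j
    split zero    = solve 1 (λ x → x := x :* con (+ 1) :+ con (+ 1) :* con (+ 0)) refl _
    split (suc j) = solve 2 (λ x y → y := x :* con (+ 0) :+ con (+ 1) :* y) refl (v zero) _

  punchIn-cases : ∀ {n} (j k : Fin (suc n)) → k ≡ j ⊎ ∃[ l ] k ≡ punchIn j l
  punchIn-cases j k with j ≟ᶠ k
  ... | yes j≡k = inj₁ (≡.sym j≡k)
  ... | no  j≢k = inj₂ (punchOut j≢k , ≡.sym (punchIn-punchOut j≢k))

  punchIn-elim : ∀ {n} (P : Fin (suc n) → Set) j → P j → (∀ l → P (punchIn j l)) → ∀ k → P k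
  punchIn-elim P j Pj P-punchIn k with punchIn-cases j k
  ... | inj₁ ≡.refl       = Pj
  ... | inj₂ (l , ≡.refl) = P-punchIn l

  insertAt-linear : ∀ {n} a b {u v w : Vector Carrier n} j → (∀ l → u l ≈ a * v l + b * w l) →
                    ∀ k → insertAt u j 0# k ≈ a * insertAt v j 0# k + b * insertAt w j 0# k
  insertAt-linear a b {u} {v} {w} j u≈ k with punchIn-cases j k
  ... | inj₁ ≡.refl = begin
    insertAt u j 0# j                                ≡⟨ insertAt-lookup u j 0# ⟩
    0#                                               ≈⟨ solve 2 (λ a b → con (+ 0) := a :* con (+ 0) :+ b :* con (+ 0)) refl a b ⟩
    a * 0# + b * 0#                                  ≡⟨ ≡.cong₂ (λ x y → a * x + b * y) (insertAt-lookup v j 0#) (insertAt-lookup w j 0#) ⟨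
    a * insertAt v j 0# j + b * insertAt w j 0# j    ∎
    where open ≈-Reasoning
  ... | inj₂ (l , ≡.refl) = begin
    insertAt u j 0# (punchIn j l)                    ≡⟨ insertAt-punchIn u j 0# l ⟩
    u l                                              ≈⟨ u≈ l ⟩
    a * v l + b * w l                                ≡⟨ ≡.cong₂ (λ x y → a * x + b * y) (insertAt-punchIn v j 0# l) (insertAt-punchIn w j 0# l) ⟨
    a * insertAt v j 0# (punchIn j l) + b * insertAt w j 0# (punchIn j l)    ∎
    where open ≈-Reasoning

  insertAt-≋ : ∀ {n} {u : Vector Carrier n} j {v} → v j ≈ 0# → (∀ l → v (punchIn j l) ≈ u l) → v ≋ insertAt u j 0#
  insertAt-≋ {u = u} j vj≈0 v≈u k with punchIn-cases j k
  ... | inj₁ ≡.refl       = trans vj≈0 (reflexive (≡.sym (insertAt-lookup u j 0#)))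
  ... | inj₂ (l , ≡.refl) = trans (v≈u l) (reflexive (≡.sym (insertAt-punchIn u j 0# l)))

  insertAt-cong : ∀ {n} {u v : Vector Carrier n} j → u ≋ v → insertAt u j 0# ≋ insertAt v j 0#
  insertAt-cong {u = u} {v} j u≋v = insertAt-≋ j (reflexive (insertAt-lookup u j 0#))
    (λ l → trans (reflexive (insertAt-punchIn u j 0# l)) (u≋v l))

  -- Padding each row with a zero in position `j` is linear. It turns a function of full rows into a
  -- function of minors, to which the induction in `alternating-unique` applies.
  insert-column-alternating : ∀ {n m} {D : Rows n (suc m) → Carrier} → IsAlternating D → ∀ j →
                              IsAlternating (λ C → D λ i → insertAt (C i) j 0#)
  insert-column-alternating D-alt j = record
    { isMultilinear = record
      { cong   = λ A≋B → cong λ i → insertAt-cong j (A≋B i)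
      ; linear = λ i a b A≈ A~B A~C → linear i a b (insertAt-linear a b j A≈)
          (λ k k≢i → insertAt-cong j (A~B k k≢i)) (λ k k≢i → insertAt-cong j (A~C k k≢i))
      }
    ; alternating = λ i k i≢k Aᵢ≋Aₖ → alternating i k i≢k (insertAt-cong j Aᵢ≋Aₖ)
    }
    where open IsAlternating D-alt

  𝟙-sym : ∀ {n} (i j : Fin n) → 𝟙 i j ≈ 𝟙 j i
  𝟙-sym i j with i ≟ᶠ j
  ... | yes ≡.refl = sym (scalar-diagonal 1# i)
  ... | no i≢j     = sym (scalar-off-diagonal 1# (i≢j ∘ ≡.sym))

  𝟙-sumˡ : ∀ {n} i (f : Vector Carrier n) → sum (λ k → 𝟙 i k * f k) ≈ f i
  𝟙-sumˡ i f = trans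
    (sum-single (λ k → 𝟙 i k * f k) i λ k k≢i → trans (*-congʳ (scalar-off-diagonal 1# (k≢i ∘ ≡.sym))) (zeroˡ (f k)))
    (trans (*-congʳ (scalar-diagonal 1# i)) (*-identityˡ (f i)))

  -- Expand along the first row, clear the column of the unit vector that it
  -- contributes, and recognise an alternating function of the minor.
  alternating-unique : ∀ {n} {D : Matrix n → Carrier} → IsAlternating D → ∀ A → D A ≈ det A * D 𝟙
  alternating-unique {zero}  {D} D-alt A = trans (IsAlternating.cong D-alt λ ()) (sym (*-identityˡ (D 𝟙)))
  alternating-unique {suc n} {D} D-alt A = begin
    D A
      ≈⟨ ∷-cong isMultilinear {A} (λ _ → refl) (λ _ _ → refl) ⟩
    D (A zero ∷ tail A)
      ≈⟨ linear-expansion (λ u → D (u ∷ tail A))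
           (λ u≋v → cong λ { zero → u≋v ; (suc i) _ → refl })
           (λ a b → ∷-linear isMultilinear a b) (A zero) ⟩
    sum (λ j → A zero j * D (𝟙 j ∷ tail A))
      ≈⟨ sum-cong-≋ (λ j → trans (*-congˡ {A zero j} (unit-row j))
           (solve 4 (λ s x d y → x :* (d :* (s :* y)) := s :* x :* d :* y) refl
             ([-1]^ (toℕ j)) (A zero j) (det (minor A j)) (D 𝟙))) ⟩
    sum (λ j → laplace A j * D 𝟙)
      ≈⟨ *-distribʳ-sum (D 𝟙) (laplace A) ⟨
    det A * D 𝟙 ∎
    where
    open ≈-Reasoning
    open IsAlternating D-alt
    unit-row : ∀ j → D (𝟙 j ∷ tail A) ≈ det (minor A j) * ([-1]^ (toℕ j) * D 𝟙)
    unit-row j = begin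
      D (𝟙 j ∷ tail A)
        ≈⟨ clear-rows (tail-multilinear isMultilinear (𝟙 j)) (𝟙 j)
             (λ B i Bᵢ≋r → alternating zero (suc i) (λ ()) (λ l → sym (Bᵢ≋r l))) (λ i → - A (suc i) j) (tail A) ⟨
      D (𝟙 j ∷ λ i l → A (suc i) l + - A (suc i) j * 𝟙 j l)
        ≈⟨ IsMultilinear.cong (tail-multilinear isMultilinear (𝟙 j)) (λ i → insertAt-≋ j
             (trans (+-congˡ (*-congˡ (scalar-diagonal 1# j)))
               (solve 1 (λ x → x :+ (:- x) :* con (+ 1) := con (+ 0)) refl (A (suc i) j)))
             (λ l → trans (+-congˡ (*-congˡ (scalar-off-diagonal 1# (punchInᵢ≢i j l ∘ ≡.sym))))
               (solve 2 (λ x y → x :+ (:- y) :* con (+ 0) := x) refl (A (suc i) (punchIn j l)) (A (suc i) j)))) ⟩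
      D (𝟙 j ∷ λ i → insertAt (minor A j i) j 0#)
        ≈⟨ alternating-unique (insert-column-alternating (tail-alternating D-alt (𝟙 j)) j) (minor A j) ⟩
      det (minor A j) * D (𝟙 j ∷ λ i → insertAt (𝟙 i) j 0#)
        ≈⟨ *-congˡ {det (minor A j)} (IsMultilinear.cong (tail-multilinear isMultilinear (𝟙 j)) λ i k →
             sym (insertAt-≋ {u = 𝟙 i} j {𝟙 (punchIn j i)} (scalar-off-diagonal 1# (punchInᵢ≢i j i)) (punched j i) k)) ⟩
      det (minor A j) * D (𝟙 j ∷ λ i → 𝟙 (punchIn j i))
        ≈⟨ *-congˡ {det (minor A j)} (front-row D-alt 𝟙 j) ⟩
      det (minor A j) * ([-1]^ (toℕ j) * D 𝟙) ∎
      where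
      punched : ∀ j (i l : Fin n) → 𝟙 (punchIn j i) (punchIn j l) ≈ 𝟙 i l
      punched j i l with i ≟ᶠ l
      ... | yes ≡.refl = scalar-diagonal 1# (punchIn j i)
      ... | no  i≢l    = scalar-off-diagonal 1# (i≢l ∘ punchIn-injective j i l)

  infixl 7 _⊗_
  _⊗_ : ∀ {n m} → Rows n m → Matrix m → Rows n m
  (A ⊗ B) i j = sum λ k → A i k * B k j

  -- For fixed `B` the left side is alternating in the rows of `A` and takes the value `det B` at
  -- `𝟙`.
  det-⊗ : ∀ {n} (A B : Matrix n) → det (A ⊗ B) ≈ det A * det B
  det-⊗ A B = trans (alternating-unique ⊗B-alternating A) (*-congˡ (det-cong λ i j → 𝟙-sumˡ i (λ k → B k j)))
    where
    ⊗-cong : ∀ {u v} → u ≋ v → ∀ j → sum (λ k → u k * B k j) ≈ sum (λ k → v k * B k j)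
    ⊗-cong u≋v j = sum-cong-≋ λ k → *-congʳ {B k j} (u≋v k)
    ⊗B-alternating : IsAlternating (λ A → det (A ⊗ B))
    ⊗B-alternating = record
      { isMultilinear = record
        { cong   = λ A≋B → det-cong λ i → ⊗-cong (A≋B i)
        ; linear = λ i a b {A} {A′} {A″} A≈ A~A′ A~A″ → det-linear i a b
            (λ j → trans
              (sum-cong-≋ λ k → trans (*-congʳ {B k j} (A≈ k))
                (solve 5 (λ a b x y z → (a :* x :+ b :* y) :* z := a :* (x :* z) :+ b :* (y :* z)) refl
                  a b (A′ i k) (A″ i k) (B k j)))
              (sum-linear a b (λ k → A′ i k * B k j) (λ k → A″ i k * B k j)))
            (λ k k≢i → ⊗-cong (A~A′ k k≢i)) (λ k k≢i → ⊗-cong (A~A″ k k≢i))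
        }
      ; alternating = λ {A} i k i≢k Aᵢ≋Aₖ → IsAlternating.alternating det-alternating {A ⊗ B} i k i≢k (⊗-cong Aᵢ≋Aₖ)
      }

  det-𝟙 : ∀ {n} → det (𝟙 {n}) ≈ 1#
  det-𝟙 {zero}  = refl
  det-𝟙 {suc n} = trans
    (sum-single (laplace (𝟙 {suc n})) zero λ { zero 0≢0 → contradiction ≡.refl 0≢0 ; (suc j) _ →
      solve 2 (λ s d → s :* con (+ 0) :* d := con (+ 0)) refl ([-1]^ (toℕ (suc j))) (det (minor (𝟙 {suc n}) (suc j))) })
    (trans (*-cong (*-identityˡ 1#) (det-𝟙 {n})) (*-identityˡ 1#))

  det-zero-column : ∀ {n} {A : Matrix n} j → (∀ i → A i j ≈ 0#) → det A ≈ 0#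
  det-zero-column {suc n} {A} j Aⱼ≈0 = sum-zero term
    where
    term : ∀ l → laplace A l ≈ 0#
    term l with punchIn-cases l j
    ... | inj₁ ≡.refl = trans (*-congʳ (*-congˡ (Aⱼ≈0 zero)))
      (solve 2 (λ s d → s :* con (+ 0) :* d := con (+ 0)) refl ([-1]^ (toℕ l)) (det (minor A l)))
    ... | inj₂ (k , ≡.refl) = trans (*-congˡ {[-1]^ (toℕ l) * A zero l} (det-zero-column {A = minor A l} k λ i → Aⱼ≈0 (suc i)))
      (zeroʳ _)

  NonZeroVector : ∀ {n} → Vector Carrier n → Set
  NonZeroVector x = ∃[ i ] ¬ x i ≈ 0#

  -- Gaussian elimination: if the first row is zero, the first unit vector is a left kernel vector;
  -- otherwise a pivot clears its column and leaves a singular matrix `B′` of smaller size.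
  det≈0⇒kernel : ∀ {n} (A : Matrix n) → det A ≈ 0# →
                 ∃[ x ] NonZeroVector x × (∀ j → sum (λ i → x i * A i j) ≈ 0#)
  det≈0⇒kernel {zero}  A 1≈0 = contradiction (sym 1≈0) 0≉1
  det≈0⇒kernel {suc n} A detA≈0 with em {NonZeroVector (A zero)}
  ... | no A₀≈0 = 𝟙 zero , (zero , 0≉1 ∘ sym) , λ j → trans (𝟙-sumˡ zero (λ i → A i j)) (vanishes j)
    where
    vanishes : ∀ j → A zero j ≈ 0#
    vanishes j with em {A zero j ≈ 0#}
    ... | yes A₀ⱼ≈0 = A₀ⱼ≈0
    ... | no  A₀ⱼ≉0 = contradiction (j , A₀ⱼ≉0) A₀≈0
  ... | yes (j , A₀ⱼ≉0) = x , (suc i , yᵢ≉0) , xA≈0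
    where
    open ≈-Reasoning
    c : Vector Carrier n
    c i = - (A (suc i) j * inv₀ (A zero j))
    B : Rows n (suc n)
    B i l = A (suc i) l + c i * A zero l
    Bⱼ≈0 : ∀ i → B i j ≈ 0#
    Bⱼ≈0 i = begin
      A (suc i) j + - (A (suc i) j * inv₀ (A zero j)) * A zero j
        ≈⟨ solve 3 (λ x y z → x :+ (:- (x :* y)) :* z := x :- x :* (y :* z)) refl (A (suc i) j) (inv₀ (A zero j)) (A zero j) ⟩
      A (suc i) j - A (suc i) j * (inv₀ (A zero j) * A zero j)
        ≈⟨ +-congˡ (-‿cong (trans (*-congˡ (inv₀-inverse A₀ⱼ≉0)) (*-identityʳ _))) ⟩
      A (suc i) j - A (suc i) j
        ≈⟨ -‿inverseʳ _ ⟩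
      0# ∎
    B′ : Matrix n
    B′ i l = B i (punchIn j l)
    detB′≈0 : det B′ ≈ 0#
    detB′≈0 = *-cancelˡ-0 A₀ⱼ≉0 ([-1]^*x≈0 (toℕ j) (begin
      [-1]^ (toℕ j) * (A zero j * det B′)   ≈⟨ *-assoc _ _ _ ⟨
      laplace (A zero ∷ B) j                ≈⟨ sum-single (laplace (A zero ∷ B)) j other ⟨
      det (A zero ∷ B)                      ≈⟨ clear-rows (tail-multilinear det-multilinear (A zero)) (A zero)
        (λ C i Cᵢ≋r → IsAlternating.alternating det-alternating {A zero ∷ C} zero (suc i) (λ ()) (λ l → sym (Cᵢ≋r l))) c (tail A) ⟩
      det (A zero ∷ tail A)                 ≈⟨ ∷-cong (det-multilinear {suc n}) {A} (λ _ → refl) (λ _ _ → refl) ⟨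
      det A                                 ≈⟨ detA≈0 ⟩
      0#                                    ∎))
      where
      other : ∀ l → l ≢ j → laplace (A zero ∷ B) l ≈ 0#
      other l l≢j with punchIn-cases l j
      ... | inj₁ j≡l = contradiction (≡.sym j≡l) l≢j
      ... | inj₂ (k , ≡.refl) = trans (*-congˡ {[-1]^ (toℕ l) * A zero l}
        (det-zero-column {A = minor (A zero ∷ B) l} k Bⱼ≈0)) (zeroʳ _)
    kernel = det≈0⇒kernel B′ detB′≈0
    y = proj₁ kernel
    i = proj₁ (proj₁ (proj₂ kernel))
    yᵢ≉0 = proj₂ (proj₁ (proj₂ kernel))
    yB≈0 : ∀ k → sum (λ i → y i * B i k) ≈ 0#
    yB≈0 = punchIn-elim (λ k → sum (λ i → y i * B i k) ≈ 0#) j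
      (sum-zero λ i → trans (*-congˡ {y i} (Bⱼ≈0 i)) (zeroʳ _)) (proj₂ (proj₂ kernel))
    -- Row `i` of `B` is row `i + 1` of `A` plus `c i` times row 0, so the combination `y` of the
    -- rows of `B` uses row 0 of `A` with total coefficient Σ y_i c_i.
    x : Vector Carrier (suc n)
    x = sum (λ i → y i * c i) ∷ y
    xA≈0 : ∀ k → sum (λ i → x i * A i k) ≈ 0#
    xA≈0 k = begin
      sum (λ i → y i * c i) * A zero k + sum (λ i → y i * A (suc i) k)
        ≈⟨ solve 3 (λ s a t → s :* a :+ t := con (+ 1) :* t :+ a :* s) refl _ _ _ ⟩
      1# * sum (λ i → y i * A (suc i) k) + A zero k * sum (λ i → y i * c i)
        ≈⟨ sum-linear 1# (A zero k) (λ i → y i * A (suc i) k) (λ i → y i * c i) ⟨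
      sum (λ i → 1# * (y i * A (suc i) k) + A zero k * (y i * c i))
        ≈⟨ sum-cong-≋ (λ i → solve 4 (λ a y b c → con (+ 1) :* (y :* b) :+ a :* (y :* c) := y :* (b :+ c :* a)) refl
             (A zero k) (y i) (A (suc i) k) (c i)) ⟩
      sum (λ i → y i * B i k)
        ≈⟨ yB≈0 k ⟩
      0# ∎

  -- Polynomial functions

  -- Boundedness on the interval from -1 to 1, with squares in place of absolute values.
  Bounded : (Carrier → Carrier) → Set
  Bounded e = ∃[ B ] ∀ h → h * h ≤ 1# → e h * e h ≤ B

  Bounded-const : ∀ a → Bounded (λ _ → a)
  Bounded-const a = a * a , λ _ _ → ≤-refl

  Bounded-id : Bounded (λ h → h)
  Bounded-id = 1# , λ _ h²≤1 → h²≤1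

  Bounded-+ : ∀ {e e′} → Bounded e → Bounded e′ → Bounded (λ h → e h + e′ h)
  Bounded-+ {e} {e′} (B , e²≤B) (B′ , e′²≤B′) = (B + B′) + (B + B′) , λ h h²≤1 → ≤-by
    (solve 4 (λ x y B B′ → B :+ B′ :+ (B :+ B′) :- (x :+ y) :* (x :+ y)
       := (B :- x :* x :+ (B′ :- y :* y)) :+ (B :- x :* x :+ (B′ :- y :* y)) :+ (x :- y) :* (x :- y)) refl (e h) (e′ h) B B′)
    (let gap = +-nonNegative (x≤y⇒0≤y-x (e²≤B h h²≤1)) (x≤y⇒0≤y-x (e′²≤B′ h h²≤1))
     in +-nonNegative (+-nonNegative gap gap) (square-nonNegative (e h - e′ h)))

  Bounded-* : ∀ {e e′} → Bounded e → Bounded e′ → Bounded (λ h → e h * e′ h)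
  Bounded-* {e} {e′} (B , e²≤B) (B′ , e′²≤B′) = B * B′ , λ h h²≤1 → ≤-by
    (solve 4 (λ x y B B′ → B :* B′ :- (x :* y) :* (x :* y)
       := B :* (B′ :- y :* y) :+ (y :* y) :* (B :- x :* x)) refl (e h) (e′ h) B B′)
    (+-nonNegative
      (*-nonNegative (≤-trans (square-nonNegative (e h)) (e²≤B h h²≤1)) (x≤y⇒0≤y-x (e′²≤B′ h h²≤1)))
      (*-nonNegative (square-nonNegative (e′ h)) (x≤y⇒0≤y-x (e²≤B h h²≤1))))

  -- A quantitative form of continuity at 0, which replaces division by t - a at
  -- the point t = a in cancel-linear-factor.
  HasBoundedSlope : (Carrier → Carrier) → Set
  HasBoundedSlope f = ∃[ e ] Bounded e × (∀ h → f h ≈ f 0# + h * e h)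

  slope-const : ∀ a → HasBoundedSlope (λ _ → a)
  slope-const a = (λ _ → 0#) , Bounded-const 0# , λ h → solve 2 (λ a h → a := a :+ h :* con (+ 0)) refl a h

  slope-id : HasBoundedSlope (λ h → h)
  slope-id = (λ _ → 1#) , Bounded-const 1# , λ h → solve 1 (λ h → h := con (+ 0) :+ h :* con (+ 1)) refl h

  slope-+ : ∀ {f g} → HasBoundedSlope f → HasBoundedSlope g → HasBoundedSlope (λ h → f h + g h)
  slope-+ {f} {g} (e , e-bounded , f≈) (e′ , e′-bounded , g≈) =
    (λ h → e h + e′ h) , Bounded-+ e-bounded e′-bounded , λ h → trans (+-cong (f≈ h) (g≈ h))
      (solve 5 (λ a b h x y → a :+ h :* x :+ (b :+ h :* y) := a :+ b :+ h :* (x :+ y)) refl (f 0#) (g 0#) h (e h) (e′ h))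

  slope-* : ∀ {f g} → HasBoundedSlope f → HasBoundedSlope g → HasBoundedSlope (λ h → f h * g h)
  slope-* {f} {g} (e , e-bounded , f≈) (e′ , e′-bounded , g≈) =
    (λ h → f 0# * e′ h + g 0# * e h + h * (e h * e′ h)) ,
    Bounded-+ (Bounded-+ (Bounded-* (Bounded-const (f 0#)) e′-bounded) (Bounded-* (Bounded-const (g 0#)) e-bounded))
      (Bounded-* Bounded-id (Bounded-* e-bounded e′-bounded)) ,
    λ h → trans (*-cong (f≈ h) (g≈ h))
      (solve 5 (λ a b h x y → (a :+ h :* x) :* (b :+ h :* y) := a :* b :+ h :* (a :* y :+ b :* x :+ h :* (x :* y))) refl
        (f 0#) (g 0#) h (e h) (e′ h))

  slope-sum : ∀ {n} (f : Fin n → Carrier → Carrier) → (∀ i → HasBoundedSlope (f i)) → HasBoundedSlope (λ h → sum λ i → f i h)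
  slope-sum {zero}  f f-slope = slope-const 0#
  slope-sum {suc n} f f-slope = slope-+ (f-slope zero) (slope-sum (tail f) λ i → f-slope (suc i))

  slope-product : ∀ {n} (f : Fin n → Carrier → Carrier) → (∀ i → HasBoundedSlope (f i)) → HasBoundedSlope (λ h → product λ i → f i h)
  slope-product {zero}  f f-slope = slope-const 1#
  slope-product {suc n} f f-slope = slope-* (f-slope zero) (slope-product (tail f) λ i → f-slope (suc i))

  slope-det : ∀ {n} (A : Fin n → Fin n → Carrier → Carrier) → (∀ i j → HasBoundedSlope (A i j)) →
              HasBoundedSlope (λ h → det λ i j → A i j h)
  slope-det {zero}  A A-slope = slope-const 1#
  slope-det {suc n} A A-slope = slope-sum (λ j h → laplace (λ i l → A i l h) j) λ j →
    slope-* (slope-* (slope-const ([-1]^ (toℕ j))) (A-slope zero j))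
      (slope-det (λ i l → A (suc i) (punchIn j l)) λ i l → A-slope (suc i) (punchIn j l))

  -- For h ≠ 0 the slope equation reads f(0) = -h e(h), so f(0)² ≤ h² B whenever h² ≤ 1; a small `h`
  -- refutes this unless f(0) is 0.
  vanishes-at-0 : ∀ {f} → HasBoundedSlope f → (∀ h → ¬ h ≈ 0# → f h ≈ 0#) → f 0# ≈ 0#
  vanishes-at-0 {f} (e , (B , e²≤B) , f≈) f≈0 with em {f 0# ≈ 0#}
  ... | yes f0≈0 = f0≈0
  ... | no  f0≉0 = square≈0⇒≈0 (antisym F≤0 0≤F)
    where
    F = f 0# * f 0#
    0≤F = square-nonNegative (f 0#)
    0≤B : 0# ≤ B
    0≤B = ≤-trans (square-nonNegative (e 0#)) (e²≤B 0# (≤-resp-≈ (sym (zeroˡ 0#)) refl 0≤1))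
    q = F + B + 1#
    0≤F+B = +-nonNegative 0≤F 0≤B
    1≤q : 1# ≤ q
    1≤q = ≤-by (solve 1 (λ x → x :+ con (+ 1) :- con (+ 1) := x) refl (F + B)) 0≤F+B
    0≤q = ≤-trans 0≤1 1≤q
    q≉0 = 1≤q⇒q≉0 1≤q
    -- Chosen so that 0 < h ≤ 1 and h B < F, against F = h² e(h)² ≤ h² B ≤ h B.
    h = F * inv₀ q
    hq≈F : h * q ≈ F
    hq≈F = trans (*-assoc _ _ _) (trans (*-congˡ (inv₀-inverse q≉0)) (*-identityʳ F))
    0≤h = *-nonNegative 0≤F (inv₀-nonNegative 0≤q)
    0≤1-h : 0# ≤ 1# - h
    0≤1-h = *-cancelˡ-nonNegative 0≤q q≉0 (≤-resp-≈ refl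
      (trans (solve 2 (λ F B → B :+ con (+ 1) := F :+ B :+ con (+ 1) :- F) refl F B)
        (trans (+-congˡ (-‿cong (sym hq≈F))) (solve 2 (λ q h → q :- h :* q := q :* (con (+ 1) :- h)) refl q h)))
      (+-nonNegative 0≤B 0≤1))
    h²≤1 : h * h ≤ 1#
    h²≤1 = ≤-by (solve 1 (λ h → con (+ 1) :- h :* h := con (+ 1) :- h :+ h :* (con (+ 1) :- h)) refl h)
      (+-nonNegative 0≤1-h (*-nonNegative 0≤h 0≤1-h))
    h≉0 : ¬ h ≈ 0#
    h≉0 h≈0 = f0≉0 (square≈0⇒≈0 (trans (sym hq≈F) (trans (*-congʳ h≈0) (zeroˡ q))))
    F≈h²e² : F ≈ h * h * (e h * e h)
    F≈h²e² = begin
      f 0# * f 0#                                        ≈⟨ *-cong f0≈ f0≈ ⟩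
      - (h * e h) * - (h * e h)                          ≈⟨ solve 2 (λ h x → (:- (h :* x)) :* (:- (h :* x)) := h :* h :* (x :* x)) refl h (e h) ⟩
      h * h * (e h * e h)                                ∎
      where
      open ≈-Reasoning
      f0≈ : f 0# ≈ - (h * e h)
      f0≈ = x-y≈0⇒x≈y (trans (solve 2 (λ x y → x :- (:- y) := x :+ y) refl (f 0#) (h * e h)) (trans (sym (f≈ h)) (f≈0 h h≉0)))
    0≤hB-F : 0# ≤ h * B - F
    0≤hB-F = ≤-resp-≈ refl
      (trans (solve 3 (λ h B x → h :* (con (+ 1) :- h) :* B :+ h :* h :* (B :- x) := h :* B :- h :* h :* x) refl h B (e h * e h))
        (+-congˡ (-‿cong (sym F≈h²e²))))
      (+-nonNegative (*-nonNegative (*-nonNegative 0≤h 0≤1-h) 0≤B) (*-nonNegative (square-nonNegative h) (x≤y⇒0≤y-x (e²≤B h h²≤1))))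
    F≤0 : F ≤ 0#
    F≤0 = ≤-by
      (trans (solve 3 (λ F B h → con (+ 0) :- F := (F :+ B :+ con (+ 1)) :* (h :* B :- F) :+ F :* F :- B :* (h :* (F :+ B :+ con (+ 1)) :- F)) refl F B h)
        (trans (+-congˡ (-‿cong (trans (*-congˡ (x≈y⇒x-y≈0 hq≈F)) (zeroʳ B)))) (trans (+-congˡ -0#≈0#) (+-identityʳ _))))
      (+-nonNegative (*-nonNegative 0≤q 0≤hB-F) 0≤F²)
      where 0≤F² = square-nonNegative F

  -- Away from `a` the factor is invertible. At `a` the difference f - g is the value at 0 of a
  -- function of bounded slope that vanishes everywhere else.
  cancel-linear-factor : ∀ {f g : Carrier → Carrier} a → HasBoundedSlope (λ h → f (a + h)) → HasBoundedSlope (λ h → g (a + h)) →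
                         (∀ {t u} → t ≈ u → f t ≈ f u) → (∀ {t u} → t ≈ u → g t ≈ g u) →
                         (∀ t → (t - a) * f t ≈ (t - a) * g t) → ∀ t → f t ≈ g t
  cancel-linear-factor {f} {g} a f-slope g-slope f-cong g-cong eq t with em {t - a ≈ 0#}
  ... | no  t-a≉0 = *-cancelˡ t-a≉0 (eq t)
  ... | yes t-a≈0 = trans (f-cong t≈a+0) (trans (x-y≈0⇒x≈y (trans
      (+-congˡ (solve 1 (λ x → :- x := con (-[1+ 0 ]) :* x) refl (g (a + 0#))))
      (vanishes-at-0 (slope-+ f-slope (slope-* (slope-const (- 1#)) g-slope)) off-0))) (sym (g-cong t≈a+0)))
    where
    t≈a+0 : t ≈ a + 0#
    t≈a+0 = trans (x-y≈0⇒x≈y t-a≈0) (sym (+-identityʳ a))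
    off-0 : ∀ h → ¬ h ≈ 0# → f (a + h) + - 1# * g (a + h) ≈ 0#
    off-0 h h≉0 = trans
      (solve 2 (λ x y → x :+ con (-[1+ 0 ]) :* y := x :- y) refl (f (a + h)) (g (a + h)))
      (x≈y⇒x-y≈0 (*-cancelˡ h≉0 (trans (*-congʳ h≈) (trans (eq (a + h)) (sym (*-congʳ h≈))))))
      where
      h≈ : h ≈ a + h - a
      h≈ = solve 2 (λ a h → h := a :+ h :- a) refl a h

  -- Quadratic forms and reflections

  infix 4 _≋ₘ_
  _≋ₘ_ : ∀ {n m} → Rows n m → Rows n m → Set
  A ≋ₘ B = ∀ i → A i ≋ B i

  infixl 7 _⊙_
  _⊙_ : ∀ {n} → Vector Carrier n → Vector Carrier n → Carrier
  u ⊙ v = sum λ i → u i * v i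

  ⊙-cong : ∀ {n} {u u′ v v′ : Vector Carrier n} → u ≋ u′ → v ≋ v′ → u ⊙ v ≈ u′ ⊙ v′
  ⊙-cong u≋u′ v≋v′ = sum-cong-≋ λ i → *-cong (u≋u′ i) (v≋v′ i)

  ⊙-comm : ∀ {n} (u v : Vector Carrier n) → u ⊙ v ≈ v ⊙ u
  ⊙-comm u v = sum-cong-≋ λ i → *-comm (u i) (v i)

  ⊙-linearʳ : ∀ {n} (u : Vector Carrier n) a b (v w : Vector Carrier n) →
              u ⊙ (λ i → a * v i + b * w i) ≈ a * (u ⊙ v) + b * (u ⊙ w)
  ⊙-linearʳ u a b v w = trans
    (sum-cong-≋ λ i → solve 5 (λ u a b v w → u :* (a :* v :+ b :* w) := a :* (u :* v) :+ b :* (u :* w)) refl (u i) a b (v i) (w i))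
    (sum-linear a b (λ i → u i * v i) (λ i → u i * w i))

  ⊙-assoc : ∀ {n m} (u : Vector Carrier n) (A : Rows n m) (v : Vector Carrier m) →
            u ⊙ (λ i → A i ⊙ v) ≈ (λ j → u ⊙ λ i → A i j) ⊙ v
  ⊙-assoc u A v = begin
    sum (λ i → u i * sum (λ j → A i j * v j))     ≈⟨ sum-cong-≋ (λ i → *-distribˡ-sum (u i) (λ j → A i j * v j)) ⟩
    sum (λ i → sum λ j → u i * (A i j * v j))     ≈⟨ ∑-comm (λ i j → u i * (A i j * v j)) ⟩
    sum (λ j → sum λ i → u i * (A i j * v j))     ≈⟨ sum-cong-≋ (λ j → sum-cong-≋ λ i → *-assoc (u i) (A i j) (v j)) ⟨
    sum (λ j → sum λ i → u i * A i j * v j)       ≈⟨ sum-cong-≋ (λ j → *-distribʳ-sum (v j) (λ i → u i * A i j)) ⟨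
    sum (λ j → sum (λ i → u i * A i j) * v j)     ∎
    where open ≈-Reasoning

  ⊗-cong : ∀ {n m} {A A′ : Rows n m} {B B′ : Matrix m} → A ≋ₘ A′ → B ≋ₘ B′ → A ⊗ B ≋ₘ A′ ⊗ B′
  ⊗-cong A≋A′ B≋B′ i j = ⊙-cong (A≋A′ i) (λ k → B≋B′ k j)

  ⊗-assoc : ∀ {n} (A B C : Matrix n) → A ⊗ B ⊗ C ≋ₘ A ⊗ (B ⊗ C)
  ⊗-assoc A B C i j = sym (⊙-assoc (A i) B (λ k → C k j))

  ⊗-identityˡ : ∀ {n} (A : Matrix n) → 𝟙 ⊗ A ≋ₘ A
  ⊗-identityˡ A i j = 𝟙-sumˡ i (λ k → A k j)

  ⊗-identityʳ : ∀ {n} (A : Matrix n) → A ⊗ 𝟙 ≋ₘ A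
  ⊗-identityʳ A i j = trans (sum-cong-≋ λ k → trans (*-comm (A i k) (𝟙 k j)) (*-congʳ (𝟙-sym k j))) (𝟙-sumˡ j (A i))

  ⊗-transpose : ∀ {n} {A B : Matrix n} → IsSymmetric A → IsSymmetric B → ∀ i j → (A ⊗ B) i j ≈ (B ⊗ A) j i
  ⊗-transpose {A = A} {B} A-sym B-sym i j = sum-cong-≋ λ k → trans (*-comm (A i k) (B k j)) (*-cong (B-sym k j) (A-sym i k))

  infix 5 ⟪_,_⟫
  -- The entrywise pairing tr(A Bᵀ), which is the trace inner product tr(AB) on symmetric matrices.
  ⟪_,_⟫ : ∀ {n} → Matrix n → Matrix n → Carrier
  ⟪ A , B ⟫ = sum λ i → A i ⊙ B i

  ⟪⟫-cong : ∀ {n} {A A′ B B′ : Matrix n} → A ≋ₘ A′ → B ≋ₘ B′ → ⟪ A , B ⟫ ≈ ⟪ A′ , B′ ⟫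
  ⟪⟫-cong A≋A′ B≋B′ = sum-cong-≋ λ i → ⊙-cong (A≋A′ i) (B≋B′ i)

  ⟪⟫-comm : ∀ {n} (A B : Matrix n) → ⟪ A , B ⟫ ≈ ⟪ B , A ⟫
  ⟪⟫-comm A B = sum-cong-≋ λ i → ⊙-comm (A i) (B i)

  ⟪⟫-linearʳ : ∀ {n} (A : Matrix n) a b (B C : Matrix n) →
               ⟪ A , (λ i j → a * B i j + b * C i j) ⟫ ≈ a * ⟪ A , B ⟫ + b * ⟪ A , C ⟫
  ⟪⟫-linearʳ A a b B C = trans (sum-cong-≋ λ i → ⊙-linearʳ (A i) a b (B i) (C i))
    (sum-linear a b (λ i → A i ⊙ B i) (λ i → A i ⊙ C i))

  trace : ∀ {n} → Matrix n → Carrier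
  trace A = sum λ i → A i i

  ⟪𝟙⟫ : ∀ {n} (A : Matrix n) → ⟪ 𝟙 , A ⟫ ≈ trace A
  ⟪𝟙⟫ A = sum-cong-≋ λ i → 𝟙-sumˡ i (A i)

  outer : ∀ {n} → Vector Carrier n → Matrix n
  outer u i j = u i * u j

  ⟪𝟙,outer⟫ : ∀ {n} (u : Vector Carrier n) → ⟪ 𝟙 , outer u ⟫ ≈ u ⊙ u
  ⟪𝟙,outer⟫ u = ⟪𝟙⟫ (outer u)

  ⟪⟫-⊗ˡ : ∀ {n} (Q A B : Matrix n) → IsSymmetric Q → ⟪ Q ⊗ A , B ⟫ ≈ ⟪ A , Q ⊗ B ⟫
  ⟪⟫-⊗ˡ Q A B Q-sym = begin
    sum (λ i → (λ j → Q i ⊙ λ k → A k j) ⊙ B i)      ≈⟨ sum-cong-≋ (λ i → ⊙-assoc (Q i) A (B i)) ⟨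
    sum (λ i → Q i ⊙ λ k → A k ⊙ B i)                ≈⟨ ∑-comm (λ i k → Q i k * (A k ⊙ B i)) ⟩
    sum (λ k → sum λ i → Q i k * (A k ⊙ B i))        ≈⟨ sum-cong-≋ (λ k → sum-cong-≋ λ i →
                                                          *-cong (Q-sym i k) (⊙-comm (A k) (B i))) ⟩
    sum (λ k → Q k ⊙ λ i → B i ⊙ A k)                ≈⟨ sum-cong-≋ (λ k → ⊙-assoc (Q k) B (A k)) ⟩
    sum (λ k → (λ j → Q k ⊙ λ i → B i j) ⊙ A k)      ≈⟨ ⟪⟫-comm (Q ⊗ B) A ⟩
    sum (λ k → A k ⊙ (λ j → Q k ⊙ λ i → B i j))      ∎
    where open ≈-Reasoning

  ⟪⟫-⊗ʳ : ∀ {n} (A Q B : Matrix n) → IsSymmetric Q → ⟪ A ⊗ Q , B ⟫ ≈ ⟪ A , B ⊗ Q ⟫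
  ⟪⟫-⊗ʳ A Q B Q-sym = sum-cong-≋ λ i → trans (sym (⊙-assoc (A i) Q (B i)))
    (sum-cong-≋ λ k → *-congˡ {A i k} (trans (⊙-comm (Q k) (B i)) (sum-cong-≋ λ j → *-congˡ {B i j} (Q-sym k j))))

  -- An orthogonal matrix that is its own transpose and inverse: conjugation is A ↦ QAQ, again an
  -- involution and self-adjoint for the pairing.
  record IsReflection {n} (Q : Matrix n) : Set where
    field
      symmetric  : IsSymmetric Q
      involutive : Q ⊗ Q ≋ₘ 𝟙

  module Conjugation {n} {Q : Matrix n} (Q-refl : IsReflection Q) where
    open IsReflection Q-refl
    open ≈-Reasoning

    conj : Matrix n → Matrix n
    conj A = Q ⊗ A ⊗ Q

    conj-linear : ∀ a b A B → conj (λ i j → a * A i j + b * B i j) ≋ₘ λ i j → a * conj A i j + b * conj B i j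
    conj-linear a b A B i j = begin
      (λ k → Q i ⊙ λ l → a * A l k + b * B l k) ⊙ (λ k → Q k j)
        ≈⟨ ⊙-cong {v = λ k → Q k j} (λ k → ⊙-linearʳ (Q i) a b (λ l → A l k) (λ l → B l k)) (λ _ → refl) ⟩
      (λ k → a * (Q ⊗ A) i k + b * (Q ⊗ B) i k) ⊙ (λ k → Q k j)
        ≈⟨ ⊙-comm (λ k → a * (Q ⊗ A) i k + b * (Q ⊗ B) i k) (λ k → Q k j) ⟩
      (λ k → Q k j) ⊙ (λ k → a * (Q ⊗ A) i k + b * (Q ⊗ B) i k)
        ≈⟨ ⊙-linearʳ (λ k → Q k j) a b ((Q ⊗ A) i) ((Q ⊗ B) i) ⟩
      a * ((λ k → Q k j) ⊙ (Q ⊗ A) i) + b * ((λ k → Q k j) ⊙ (Q ⊗ B) i)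
        ≈⟨ +-cong (*-congˡ (⊙-comm (λ k → Q k j) ((Q ⊗ A) i))) (*-congˡ (⊙-comm (λ k → Q k j) ((Q ⊗ B) i))) ⟩
      a * conj A i j + b * conj B i j ∎

    conj-𝟙 : conj 𝟙 ≋ₘ 𝟙
    conj-𝟙 i j = trans (⊗-cong {B = Q} (⊗-identityʳ Q) (λ _ _ → refl) i j) (involutive i j)

    conj-conj : ∀ A → conj (conj A) ≋ₘ A
    conj-conj A i j = begin
      (Q ⊗ (Q ⊗ A ⊗ Q) ⊗ Q) i j     ≈⟨ ⊗-assoc Q (Q ⊗ A ⊗ Q) Q i j ⟩
      (Q ⊗ (Q ⊗ A ⊗ Q ⊗ Q)) i j     ≈⟨ ⊗-cong {A = Q} (λ _ _ → refl) (⊗-assoc (Q ⊗ A) Q Q) i j ⟩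
      (Q ⊗ (Q ⊗ A ⊗ (Q ⊗ Q))) i j   ≈⟨ ⊗-cong {A = Q} (λ _ _ → refl) (⊗-cong {A = Q ⊗ A} (λ _ _ → refl) involutive) i j ⟩
      (Q ⊗ (Q ⊗ A ⊗ 𝟙)) i j         ≈⟨ ⊗-cong {A = Q} (λ _ _ → refl) (⊗-identityʳ (Q ⊗ A)) i j ⟩
      (Q ⊗ (Q ⊗ A)) i j             ≈⟨ ⊗-assoc Q Q A i j ⟨
      (Q ⊗ Q ⊗ A) i j               ≈⟨ ⊗-cong {B = A} involutive (λ _ _ → refl) i j ⟩
      (𝟙 ⊗ A) i j                   ≈⟨ ⊗-identityˡ A i j ⟩
      A i j                         ∎

    conj-adjoint : ∀ A B → ⟪ conj A , B ⟫ ≈ ⟪ A , conj B ⟫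
    conj-adjoint A B = begin
      ⟪ Q ⊗ A ⊗ Q , B ⟫       ≈⟨ ⟪⟫-⊗ʳ (Q ⊗ A) Q B symmetric ⟩
      ⟪ Q ⊗ A , B ⊗ Q ⟫       ≈⟨ ⟪⟫-⊗ˡ Q A (B ⊗ Q) symmetric ⟩
      ⟪ A , Q ⊗ (B ⊗ Q) ⟫     ≈⟨ ⟪⟫-cong {A = A} (λ _ _ → refl) (⊗-assoc Q B Q) ⟨
      ⟪ A , Q ⊗ B ⊗ Q ⟫       ∎

    conj-⟪⟫ : ∀ A B → ⟪ conj A , conj B ⟫ ≈ ⟪ A , B ⟫
    conj-⟪⟫ A B = trans (conj-adjoint A (conj B)) (⟪⟫-cong {A = A} (λ _ _ → refl) (conj-conj B))

    conj-trace : ∀ A → trace (conj A) ≈ trace A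
    conj-trace A = begin
      trace (conj A)         ≈⟨ ⟪𝟙⟫ (conj A) ⟨
      ⟪ 𝟙 , conj A ⟫         ≈⟨ conj-adjoint 𝟙 A ⟨
      ⟪ conj 𝟙 , A ⟫         ≈⟨ ⟪⟫-cong {B = A} conj-𝟙 (λ _ _ → refl) ⟩
      ⟪ 𝟙 , A ⟫              ≈⟨ ⟪𝟙⟫ A ⟩
      trace A                ∎

    conj-outer : ∀ u → conj (outer u) ≋ₘ outer (λ i → Q i ⊙ u)
    conj-outer u i j = begin
      sum (λ k → (Q i ⊙ λ l → u l * u k) * Q k j)
        ≈⟨ sum-cong-≋ (λ k → trans (*-congʳ {Q k j} (trans (sum-cong-≋ λ l → sym (*-assoc (Q i l) (u l) (u k)))
             (sym (*-distribʳ-sum (u k) (λ l → Q i l * u l)))))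
             (trans (*-congˡ {Q i ⊙ u * u k} (symmetric k j)) (solve 3 (λ s x y → s :* x :* y := s :* (y :* x)) refl (Q i ⊙ u) (u k) (Q j k)))) ⟩
      sum (λ k → (Q i ⊙ u) * (Q j k * u k))
        ≈⟨ *-distribˡ-sum (Q i ⊙ u) (λ k → Q j k * u k) ⟨
      (Q i ⊙ u) * (Q j ⊙ u) ∎

    conj-symmetric : ∀ {A} → IsSymmetric A → IsSymmetric (conj A)
    conj-symmetric {A} A-sym i j = begin
      (Q ⊗ A ⊗ Q) i j                   ≈⟨ sum-cong-≋ (λ k → trans (*-congʳ {Q k j} (⊗-transpose symmetric A-sym i k))
                                            (trans (*-comm ((A ⊗ Q) k i) (Q k j)) (*-congʳ {(A ⊗ Q) k i} (symmetric k j)))) ⟩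
      (Q ⊗ (A ⊗ Q)) j i                 ≈⟨ ⊗-assoc Q A Q j i ⟨
      (Q ⊗ A ⊗ Q) j i                   ∎

    conj-det : ∀ A → det (conj A) ≈ det A
    conj-det A = begin
      det (Q ⊗ A ⊗ Q)           ≈⟨ det-⊗ (Q ⊗ A) Q ⟩
      det (Q ⊗ A) * det Q       ≈⟨ *-congʳ (det-⊗ Q A) ⟩
      det Q * det A * det Q     ≈⟨ solve 2 (λ q a → q :* a :* q := q :* q :* a) refl (det Q) (det A) ⟩
      det Q * det Q * det A     ≈⟨ *-congʳ (det-⊗ Q Q) ⟨
      det (Q ⊗ Q) * det A       ≈⟨ *-congʳ (trans (det-cong involutive) (det-𝟙 {n})) ⟩
      1# * det A                ≈⟨ *-identityˡ (det A) ⟩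
      det A                     ∎

  scalar≈ : ∀ {n} t (i j : Fin n) → scalar t i j ≈ t * 𝟙 i j
  scalar≈ t i j with i ≟ᶠ j
  ... | yes _ = sym (*-identityʳ t)
  ... | no  _ = sym (zeroʳ t)

  sum-nonNegative : ∀ {n} {f : Vector Carrier n} → (∀ i → 0# ≤ f i) → 0# ≤ sum f
  sum-nonNegative {zero}  0≤f = ≤-refl
  sum-nonNegative {suc n} 0≤f = +-nonNegative (0≤f zero) (sum-nonNegative λ i → 0≤f (suc i))

  sum-mono : ∀ {n} {f g : Vector Carrier n} → (∀ i → f i ≤ g i) → sum f ≤ sum g
  sum-mono {zero}  f≤g = ≤-refl
  sum-mono {suc n} f≤g = +-mono-≤ (f≤g zero) (sum-mono λ i → f≤g (suc i))

  term≤sum : ∀ {n} {f : Vector Carrier n} → (∀ i → 0# ≤ f i) → ∀ i → f i ≤ sum f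
  term≤sum {f = f} 0≤f zero    = ≤-by (solve 2 (λ x y → x :+ y :- x := y) refl (f zero) (sum (tail f))) (sum-nonNegative λ i → 0≤f (suc i))
  term≤sum {f = f} 0≤f (suc i) = ≤-trans (term≤sum (λ i → 0≤f (suc i)) i)
    (≤-by (solve 2 (λ x y → x :+ y :- y := x) refl (f zero) (sum (tail f))) (0≤f zero))

  ⊙-nonNegative : ∀ {n} (u : Vector Carrier n) → 0# ≤ u ⊙ u
  ⊙-nonNegative u = sum-nonNegative λ i → square-nonNegative (u i)

  ⊙-self≈0 : ∀ {n} {u : Vector Carrier n} → u ⊙ u ≈ 0# → ∀ i → u i ≈ 0#
  ⊙-self≈0 {u = u} u⊙u≈0 i = square≈0⇒≈0 (antisym
    (≤-resp-≈ refl u⊙u≈0 (term≤sum (λ i → square-nonNegative (u i)) i)) (square-nonNegative (u i)))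

  -- Of the two roots ±|v| at least one differs from `x`, since r = -r would give 2r = 0. With `x`
  -- the first coordinate of `v` this keeps the normal v - s e₀ of the reflection non-zero.
  norm-avoiding : ∀ {n} (v : Vector Carrier n) → NonZeroVector v → ∀ x →
                  ∃[ s ] s * s ≈ v ⊙ v × ¬ s ≈ 0# × ¬ x - s ≈ 0#
  norm-avoiding v (i , vᵢ≉0) x with sqrt (⊙-nonNegative v)
  ... | r , r²≈v⊙v with em {x - r ≈ 0#}
  ...   | no  x≉r = r , r²≈v⊙v , r≉0 , x≉r
    where
    r≉0 : ¬ r ≈ 0#
    r≉0 r≈0 = vᵢ≉0 (⊙-self≈0 (trans (sym r²≈v⊙v) (trans (*-congʳ r≈0) (zeroˡ r))) i)
  ...   | yes x≈r = - r , -r²≈v⊙v , -r≉0 , x≉-r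
    where
    open ≈-Reasoning
    -r²≈v⊙v : - r * - r ≈ v ⊙ v
    -r²≈v⊙v = trans (solve 1 (λ r → (:- r) :* (:- r) := r :* r) refl r) r²≈v⊙v
    -r≉0 : ¬ - r ≈ 0#
    -r≉0 -r≈0 = vᵢ≉0 (⊙-self≈0 (trans (sym -r²≈v⊙v) (trans (*-congʳ -r≈0) (zeroˡ (- r)))) i)
    x≉-r : ¬ x - - r ≈ 0#
    x≉-r x≈-r = -r≉0 (trans (-‿cong (*-cancelˡ-0 2≉0 (begin
      (1# + 1#) * r           ≈⟨ solve 2 (λ r x → (con (+ 1) :+ con (+ 1)) :* r := x :- (:- r) :- (x :- r)) refl r x ⟩
      x - - r - (x - r)       ≈⟨ +-cong x≈-r (-‿cong x≈r) ⟩
      0# - 0#                 ≈⟨ -‿inverseʳ 0# ⟩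
      0#                      ∎))) -0#≈0#)

  ⊙-𝟙 : ∀ {n} (u : Vector Carrier n) i → u ⊙ 𝟙 i ≈ u i
  ⊙-𝟙 u i = trans (⊙-comm u (𝟙 i)) (𝟙-sumˡ i u)

  -- The matrix I - c u uᵀ. The factor `1#` gives each row the shape of a linear combination as in
  -- `⊙-linearʳ`.
  householder : ∀ {n} → Carrier → Vector Carrier n → Matrix n
  householder c u i j = 1# * 𝟙 i j + - c * u i * u j

  householder-reflection : ∀ {n} c (u : Vector Carrier n) → c * (u ⊙ u) ≈ 1# + 1# → IsReflection (householder c u)
  householder-reflection c u c[u⊙u]≈2 = record { symmetric = Q-sym ; involutive = λ i j → begin
      (Q i ⊙ λ k → Q k j)
        ≈⟨ ⊙-cong {u = Q i} (λ _ → refl) (λ k → Q-sym k j) ⟩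
      Q i ⊙ Q j
        ≈⟨ ⊙Q (Q i) j ⟩
      1# * Q i j + - c * u j * (Q i ⊙ u)
        ≈⟨ +-congˡ (*-congˡ (trans (⊙-comm (Q i) u) (⊙Q u i))) ⟩
      1# * Q i j + - c * u j * (1# * u i + - c * u i * (u ⊙ u))
        ≈⟨ solve 5 (λ δ c x y N → con (+ 1) :* (con (+ 1) :* δ :+ (:- c) :* x :* y) :+ (:- c) :* y :* (con (+ 1) :* x :+ (:- c) :* x :* N)
             := δ :+ c :* x :* y :* (c :* N :- (con (+ 1) :+ con (+ 1)))) refl (𝟙 i j) c (u i) (u j) (u ⊙ u) ⟩
      𝟙 i j + c * u i * u j * (c * (u ⊙ u) - (1# + 1#))
        ≈⟨ +-congˡ (trans (*-congˡ (x≈y⇒x-y≈0 c[u⊙u]≈2)) (zeroʳ _)) ⟩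
      𝟙 i j + 0#
        ≈⟨ +-identityʳ _ ⟩
      𝟙 i j ∎ }
    where
    open ≈-Reasoning
    Q = householder c u
    Q-sym : IsSymmetric Q
    Q-sym i j = +-cong (*-congˡ (𝟙-sym i j)) (solve 3 (λ c x y → (:- c) :* x :* y := (:- c) :* y :* x) refl c (u i) (u j))
    ⊙Q : ∀ w j → w ⊙ Q j ≈ 1# * w j + - c * u j * (w ⊙ u)
    ⊙Q w j = trans (⊙-linearʳ w 1# (- c * u j) (𝟙 j) u) (+-congʳ (*-congˡ (⊙-𝟙 w j)))

  -- The reflection that exchanges v and s e₀. As s ≠ v₀, the normal
  -- u = v - s e₀ is non-zero: |u|² = -2 s u₀.
  reflection-to-axis : ∀ {n} (v : Vector Carrier (suc n)) s → s * s ≈ v ⊙ v → ¬ s ≈ 0# → ¬ v zero - s ≈ 0# →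
                       ∃[ Q ] IsReflection Q × (∀ i → s * Q i zero ≈ v i)
  reflection-to-axis v s s²≈v⊙v s≉0 v₀≉s = householder c u , householder-reflection c u c[u⊙u]≈2 , sQ≈v
    where
    open ≈-Reasoning
    u : Vector Carrier _
    u i = 1# * v i + - s * 𝟙 zero i
    u₀≉0 : ¬ u zero ≈ 0#
    u₀≉0 u₀≈0 = v₀≉s (trans (solve 2 (λ v s → v :- s := con (+ 1) :* v :+ (:- s) :* con (+ 1)) refl (v zero) s) u₀≈0)
    -- This is 2/|u|², by |u|² = -2 s u₀.
    c = - inv₀ (s * u zero)
    csu₀≈-1 : c * (s * u zero) ≈ - 1#
    csu₀≈-1 = trans (solve 2 (λ x y → (:- x) :* y := :- (x :* y)) refl (inv₀ (s * u zero)) (s * u zero))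
      (-‿cong (inv₀-inverse λ su₀≈0 → u₀≉0 (*-cancelˡ-0 s≉0 su₀≈0)))
    u⊙u≈-2su₀ : u ⊙ u ≈ - (1# + 1#) * (s * u zero)
    u⊙u≈-2su₀ = begin
      u ⊙ u
        ≈⟨ ⊙-linearʳ u 1# (- s) v (𝟙 zero) ⟩
      1# * (u ⊙ v) + - s * (u ⊙ 𝟙 zero)
        ≈⟨ +-cong (*-congˡ (trans (⊙-comm u v) (⊙-linearʳ v 1# (- s) v (𝟙 zero)))) (*-congˡ (⊙-𝟙 u zero)) ⟩
      1# * (1# * (v ⊙ v) + - s * (v ⊙ 𝟙 zero)) + - s * u zero
        ≈⟨ +-congʳ (*-congˡ (+-cong (*-congˡ (sym s²≈v⊙v)) (*-congˡ (⊙-𝟙 v zero)))) ⟩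
      1# * (1# * (s * s) + - s * v zero) + - s * u zero
        ≈⟨ solve 2 (λ s v → con (+ 1) :* (con (+ 1) :* (s :* s) :+ (:- s) :* v) :+ (:- s) :* (con (+ 1) :* v :+ (:- s) :* con (+ 1))
             := (:- (con (+ 1) :+ con (+ 1))) :* (s :* (con (+ 1) :* v :+ (:- s) :* con (+ 1)))) refl s (v zero) ⟩
      - (1# + 1#) * (s * u zero) ∎
    c[u⊙u]≈2 : c * (u ⊙ u) ≈ 1# + 1#
    c[u⊙u]≈2 = begin
      c * (u ⊙ u)                         ≈⟨ *-congˡ u⊙u≈-2su₀ ⟩
      c * (- (1# + 1#) * (s * u zero))    ≈⟨ solve 3 (λ c t x → c :* ((:- t) :* x) := (:- t) :* (c :* x)) refl c (1# + 1#) (s * u zero) ⟩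
      - (1# + 1#) * (c * (s * u zero))    ≈⟨ *-congˡ csu₀≈-1 ⟩
      - (1# + 1#) * - 1#                  ≈⟨ solve 0 ((:- (con (+ 1) :+ con (+ 1))) :* (:- con (+ 1)) := con (+ 1) :+ con (+ 1)) refl ⟩
      1# + 1#                             ∎
    sQ≈v : ∀ i → s * householder c u i zero ≈ v i
    sQ≈v i = begin
      s * (1# * 𝟙 i zero + - c * u i * u zero)
        ≈⟨ solve 5 (λ s δ c x y → s :* (con (+ 1) :* δ :+ (:- c) :* x :* y) := s :* δ :- x :* (c :* (s :* y))) refl s (𝟙 i zero) c (u i) (u zero) ⟩
      s * 𝟙 i zero - u i * (c * (s * u zero))
        ≈⟨ +-cong (*-congˡ (𝟙-sym i zero)) (-‿cong (*-congˡ csu₀≈-1)) ⟩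
      s * 𝟙 zero i - (1# * v i + - s * 𝟙 zero i) * - 1#
        ≈⟨ solve 3 (λ s δ v → s :* δ :- (con (+ 1) :* v :+ (:- s) :* δ) :* (:- con (+ 1)) := v) refl s (𝟙 zero i) (v i) ⟩
      v i ∎

  -- Spectra

  scalar-cong : ∀ {n t u} (i j : Fin n) → t ≈ u → scalar t i j ≈ scalar u i j
  scalar-cong i j t≈u with i ≟ᶠ j
  ... | yes _ = t≈u
  ... | no  _ = refl

  charpoly-cong : ∀ {n} (M : Matrix n) {t u} → t ≈ u → charpoly M t ≈ charpoly M u
  charpoly-cong {n} M t≈u = det-cong {n} λ i j → +-congʳ {x = - M i j} (scalar-cong i j t≈u)

  product-cong : ∀ {n} {f g : Vector Carrier n} → f ≋ g → product f ≈ product g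
  product-cong {zero}  f≋g = refl
  product-cong {suc n} f≋g = *-cong (f≋g zero) (product-cong λ i → f≋g (suc i))

  slope-if : ∀ b {f g} → HasBoundedSlope f → HasBoundedSlope g → HasBoundedSlope (λ h → if b then f h else g h)
  slope-if true  f-slope g-slope = f-slope
  slope-if false f-slope g-slope = g-slope

  slope-shift : ∀ a b → HasBoundedSlope (λ h → a + h - b)
  slope-shift a b = slope-+ (slope-+ (slope-const a) slope-id) (slope-const (- b))

  slope-charpoly : ∀ {n} (M : Matrix n) a → HasBoundedSlope (λ h → charpoly M (a + h))
  slope-charpoly M a = slope-det (λ i j h → scalar (a + h) i j - M i j) λ i j →
    slope-+ (slope-if (does (i ≟ᶠ j)) (slope-+ (slope-const a) slope-id) (slope-const 0#)) (slope-const (- M i j))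

  HasEigenvalues : ∀ {n} → Matrix n → Vector Carrier n → Set
  HasEigenvalues M μ = ∀ t → charpoly M t ≈ product (λ i → t - μ i)

  block : ∀ {n} → Matrix (suc n) → Matrix n
  block A = minor A zero

  -- Since Q² = I, tI - QMQ = Q(tI - M)Q, and det Q occurs squared.
  charpoly-conj : ∀ {n} {Q : Matrix n} (Q-refl : IsReflection Q) (M : Matrix n) t →
                  charpoly (Conjugation.conj Q-refl M) t ≈ charpoly M t
  charpoly-conj {Q = Q} Q-refl M t = begin
    det (λ i j → scalar t i j - conj M i j)
      ≈⟨ det-cong (λ i j → +-cong (trans (scalar≈ t i j) (*-congˡ (sym (conj-𝟙 i j)))) (neg (conj M i j))) ⟩
    det (λ i j → t * conj 𝟙 i j + - 1# * conj M i j)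
      ≈⟨ det-cong (conj-linear t (- 1#) 𝟙 M) ⟨
    det (conj (λ i j → t * 𝟙 i j + - 1# * M i j))
      ≈⟨ conj-det (λ i j → t * 𝟙 i j + - 1# * M i j) ⟩
    det (λ i j → t * 𝟙 i j + - 1# * M i j)
      ≈⟨ det-cong (λ i j → +-cong (scalar≈ t i j) (neg (M i j))) ⟨
    det (λ i j → scalar t i j - M i j) ∎
    where
    open Conjugation Q-refl
    open ≈-Reasoning
    neg : ∀ x → - x ≈ - 1# * x
    neg = solve 1 (λ x → :- x := (:- con (+ 1)) :* x) refl

  charpoly-block : ∀ {n} (M : Matrix (suc n)) μ → (∀ j → M zero j ≈ μ * 𝟙 zero j) →
                   ∀ t → charpoly M t ≈ (t - μ) * charpoly (block M) t
  charpoly-block M μ M₀≈ t = trans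
    (sum-single (laplace T) zero λ
      { zero 0≢0    → contradiction ≡.refl 0≢0
      ; (suc j) _   → trans (*-congʳ {det (minor T (suc j))} (*-congˡ {[-1]^ (toℕ (suc j))} (+-congˡ {0#} (-‿cong (M₀≈ (suc j))))))
          (solve 3 (λ s m d → s :* (con (+ 0) :- m :* con (+ 0)) :* d := con (+ 0)) refl
            ([-1]^ (toℕ (suc j))) μ (det (minor T (suc j)))) })
    (*-congʳ {det (minor T zero)} (trans (*-identityˡ (T zero zero)) (+-congˡ (-‿cong (trans (M₀≈ zero) (*-identityʳ μ))))))
    where
    T : Matrix _
    T i j = scalar t i j - M i j

  -- The singular matrix μI - M has a left kernel vector; symmetry of `M` makes it a right
  -- eigenvector.
  eigenvalue⇒eigenvector : ∀ {n} {M : Matrix n} → IsSymmetric M → ∀ μ → charpoly M μ ≈ 0# →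
                           ∃[ v ] NonZeroVector v × (∀ j → M j ⊙ v ≈ μ * v j)
  eigenvalue⇒eigenvector {M = M} M-sym μ charpoly≈0 = v , proj₁ (proj₂ kernel) , λ j → sym (x-y≈0⇒x≈y (begin
    μ * v j - M j ⊙ v
      ≈⟨ solve 3 (λ μ x y → μ :* x :- y := μ :* x :+ (:- con (+ 1)) :* y) refl μ (v j) (M j ⊙ v) ⟩
    μ * v j + - 1# * (M j ⊙ v)
      ≈⟨ +-cong (*-congˡ (⊙-𝟙 v j)) (*-congˡ (⊙-comm v (M j))) ⟨
    μ * (v ⊙ 𝟙 j) + - 1# * (v ⊙ M j)
      ≈⟨ ⊙-linearʳ v μ (- 1#) (𝟙 j) (M j) ⟨
    v ⊙ (λ i → μ * 𝟙 j i + - 1# * M j i)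
      ≈⟨ ⊙-cong {u = v} (λ _ → refl) (λ i → +-cong (trans (scalar≈ μ i j) (*-congˡ (𝟙-sym i j)))
           (trans (-‿cong (M-sym i j)) (solve 1 (λ x → :- x := (:- con (+ 1)) :* x) refl (M j i)))) ⟨
    v ⊙ (λ i → scalar μ i j - M i j)
      ≈⟨ proj₂ (proj₂ kernel) j ⟩
    0# ∎))
    where
    open ≈-Reasoning
    kernel = det≈0⇒kernel (λ i j → scalar μ i j - M i j) charpoly≈0
    v = proj₁ kernel

  -- The reflection is part of the data because its first column, a unit eigenvector for `μ zero`,
  -- is later the vector from which a colour average is built. The block keeps the remaining
  -- eigenvalues in their given order.
  record Deflation {n} (M : Matrix (suc n)) (μ : Vector Carrier (suc n)) : Set where
    field
      Q            : Matrix (suc n)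
      isReflection : IsReflection Q
    open Conjugation isReflection public
    field
      first-row    : ∀ j → conj M zero j ≈ μ zero * 𝟙 zero j
      eigenvalues  : HasEigenvalues (block (conj M)) (tail μ)

  deflate : ∀ {n} {M : Matrix (suc n)} {μ} → IsSymmetric M → HasEigenvalues M μ → Deflation M μ
  deflate {n} {M} {μ} M-sym M-eig = record
    { Q = Q ; isReflection = Q-refl ; first-row = first-row ; eigenvalues = eigenvalues }
    where
    open ≈-Reasoning
    μ₀ = μ zero
    eigenvector = eigenvalue⇒eigenvector M-sym μ₀ (trans (M-eig μ₀) (trans (*-congʳ (-‿inverseʳ μ₀)) (zeroˡ _)))
    v = proj₁ eigenvector
    Mv≈μv = proj₂ (proj₂ eigenvector)
    norm = norm-avoiding v (proj₁ (proj₂ eigenvector)) (v zero)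
    s = proj₁ norm
    s≉0 = proj₁ (proj₂ (proj₂ norm))
    reflection = reflection-to-axis v s (proj₁ (proj₂ norm)) s≉0 (proj₂ (proj₂ (proj₂ norm)))
    Q = proj₁ reflection
    Q-refl = proj₁ (proj₂ reflection)
    sQ≈v = proj₂ (proj₂ reflection)
    open IsReflection Q-refl
    open Conjugation Q-refl
    -- The first column of `Q`, hence by symmetry its first row, is v/s; the eigenvector equation
    -- passes to it because `s` can be cancelled.
    QM₀≈ : ∀ k → (Q ⊗ M) zero k ≈ μ₀ * Q zero k
    QM₀≈ k = *-cancelˡ s≉0 (begin
      s * (Q zero ⊙ λ i → M i k)               ≈⟨ *-distribˡ-sum s (λ i → Q zero i * M i k) ⟩
      sum (λ i → s * (Q zero i * M i k))       ≈⟨ sum-cong-≋ (λ i → trans (sym (*-assoc s (Q zero i) (M i k)))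
        (trans (*-cong (trans (*-congˡ (symmetric zero i)) (sQ≈v i)) (M-sym i k)) (*-comm (v i) (M k i)))) ⟩
      M k ⊙ v                                  ≈⟨ Mv≈μv k ⟩
      μ₀ * v k                                 ≈⟨ *-congˡ (trans (*-congˡ (symmetric zero k)) (sQ≈v k)) ⟨
      μ₀ * (s * Q zero k)                      ≈⟨ solve 3 (λ m s q → m :* (s :* q) := s :* (m :* q)) refl μ₀ s (Q zero k) ⟩
      s * (μ₀ * Q zero k)                      ∎)
    first-row : ∀ j → conj M zero j ≈ μ₀ * 𝟙 zero j
    first-row j = begin
      sum (λ k → (Q ⊗ M) zero k * Q k j)       ≈⟨ sum-cong-≋ (λ k → trans (*-congʳ {Q k j} (QM₀≈ k)) (*-assoc μ₀ (Q zero k) (Q k j))) ⟩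
      sum (λ k → μ₀ * (Q zero k * Q k j))      ≈⟨ *-distribˡ-sum μ₀ (λ k → Q zero k * Q k j) ⟨
      μ₀ * (Q ⊗ Q) zero j                      ≈⟨ *-congˡ (involutive zero j) ⟩
      μ₀ * 𝟙 zero j                            ∎
    eigenvalues : HasEigenvalues (block (conj M)) (tail μ)
    eigenvalues = cancel-linear-factor μ₀
      (slope-charpoly (block (conj M)) μ₀)
      (slope-product (λ i h → μ₀ + h - μ (suc i)) λ i → slope-shift μ₀ (μ (suc i)))
      (charpoly-cong (block (conj M)))
      (λ t≈u → product-cong λ i → +-congʳ {x = - μ (suc i)} t≈u)
      (λ t → begin
        (t - μ₀) * charpoly (block (conj M)) t   ≈⟨ charpoly-block (conj M) μ₀ first-row t ⟨
        charpoly (conj M) t                      ≈⟨ charpoly-conj Q-refl M t ⟩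
        charpoly M t                             ≈⟨ M-eig t ⟩
        product (λ i → t - μ i)                  ∎)

  ⟪,outer⟫ : ∀ {n} (A : Matrix n) u → ⟪ A , outer u ⟫ ≈ u ⊙ (λ i → A i ⊙ u)
  ⟪,outer⟫ A u = sum-cong-≋ λ i → trans
    (sum-cong-≋ λ j → solve 3 (λ a x y → a :* (x :* y) := x :* (a :* y)) refl (A i j) (u i) (u j))
    (sym (*-distribˡ-sum (u i) (λ j → A i j * u j)))

  -- The condition 0 ≼ X ≼ I on the quadratic form of X.
  IsContraction : ∀ {n} → Matrix n → Set
  IsContraction X = ∀ p → 0# ≤ ⟪ X , outer p ⟫ × ⟪ X , outer p ⟫ ≤ p ⊙ p

  module _ {n} {Q : Matrix n} (Q-refl : IsReflection Q) where
    open Conjugation Q-refl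

    conj-quadratic : ∀ A p → ⟪ conj A , outer p ⟫ ≈ ⟪ A , outer (λ i → Q i ⊙ p) ⟫
    conj-quadratic A p = trans (conj-adjoint A (outer p)) (⟪⟫-cong {A = A} (λ _ _ → refl) (conj-outer p))

    conj-norm : ∀ p → (λ i → Q i ⊙ p) ⊙ (λ i → Q i ⊙ p) ≈ p ⊙ p
    conj-norm p = begin
      Qp ⊙ Qp                      ≈⟨ ⟪𝟙,outer⟫ Qp ⟨
      ⟪ 𝟙 , outer Qp ⟫             ≈⟨ conj-quadratic 𝟙 p ⟨
      ⟪ conj 𝟙 , outer p ⟫         ≈⟨ ⟪⟫-cong {B = outer p} conj-𝟙 (λ _ _ → refl) ⟩
      ⟪ 𝟙 , outer p ⟫              ≈⟨ ⟪𝟙,outer⟫ p ⟩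
      p ⊙ p                        ∎
      where
      open ≈-Reasoning
      Qp = λ i → Q i ⊙ p

    conj-contraction : ∀ {X} → IsContraction X → IsContraction (conj X)
    conj-contraction {X} X-contr p =
      ≤-resp-≈ refl (sym (conj-quadratic X p)) (proj₁ (X-contr Qp)) ,
      ≤-resp-≈ (sym (conj-quadratic X p)) (conj-norm p) (proj₂ (X-contr Qp))
      where Qp = λ i → Q i ⊙ p

  block-contraction : ∀ {n} {X : Matrix (suc n)} → IsContraction X → IsContraction (block X)
  block-contraction {X = X} X-contr p =
    ≤-resp-≈ refl quadratic (proj₁ (X-contr (0# ∷ p))) ,
    ≤-resp-≈ quadratic (trans (+-congʳ (zeroˡ 0#)) (+-identityˡ (p ⊙ p))) (proj₂ (X-contr (0# ∷ p)))
    where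
    quadratic : ⟪ X , outer (0# ∷ p) ⟫ ≈ ⟪ block X , outer p ⟫
    quadratic = trans
      (+-cong (sum-zero λ j → trans (*-congˡ {X zero j} (zeroˡ ((0# ∷ p) j))) (zeroʳ (X zero j)))
        (sum-cong-≋ λ i → trans (+-congʳ (solve 2 (λ x y → x :* (y :* con (+ 0)) := con (+ 0)) refl (X (suc i) zero) (p i)))
          (+-identityˡ (X (suc i) ∘ suc ⊙ λ j → p i * p j))))
      (+-identityˡ ⟪ block X , outer p ⟫)

  -- The diagonal of `X` in an eigenbasis of `M`, its i-th entry belonging to the i-th listed
  -- eigenvalue; the basis itself is not part of the data.
  record Weights {n} (M : Matrix n) (μ : Vector Carrier n) (X : Matrix n) : Set where
    field
      x           : Vector Carrier n
      nonNegative : ∀ i → 0# ≤ x i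
      ≤1          : ∀ i → x i ≤ 1#
      total≈trace : sum x ≈ trace X
      pairing     : μ ⊙ x ≈ ⟪ M , X ⟫

  module _ {n} {M : Matrix (suc n)} {μ} (M-sym : IsSymmetric M) (deflation : Deflation M μ) where
    open Deflation deflation
    open IsReflection isReflection
    open ≈-Reasoning

    axis : Vector Carrier (suc n)
    axis i = Q i zero

    axis-normed : axis ⊙ axis ≈ 1#
    axis-normed = trans (sum-cong-≋ λ i → *-congʳ {Q i zero} (symmetric i zero)) (involutive zero zero)

    -- Evaluating the form of `X` on the unit vector `axis` bounds the new weight by 0 and 1, and
    -- makes it equal to 1 when `X` attains the norm of `axis`.
    corner : ∀ X → conj X zero zero ≈ ⟪ X , outer axis ⟫
    corner X = begin
      conj X zero zero                                ≈⟨ ⊙-𝟙 (conj X zero) zero ⟨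
      conj X zero ⊙ 𝟙 zero                            ≈⟨ 𝟙-sumˡ zero (λ i → conj X i ⊙ 𝟙 zero) ⟨
      𝟙 zero ⊙ (λ i → conj X i ⊙ 𝟙 zero)              ≈⟨ ⟪,outer⟫ (conj X) (𝟙 zero) ⟨
      ⟪ conj X , outer (𝟙 zero) ⟫                     ≈⟨ conj-quadratic isReflection X (𝟙 zero) ⟩
      ⟪ X , outer (λ i → Q i ⊙ 𝟙 zero) ⟫              ≈⟨ ⟪⟫-cong {A = X} (λ _ _ → refl) (λ i j →
                                                           *-cong (⊙-𝟙 (Q i) zero) (⊙-𝟙 (Q j) zero)) ⟩
      ⟪ X , outer axis ⟫                              ∎

    -- After conjugation the first row and column of `M` vanish off the corner, so the entries of
    -- `X` there contribute nothing and ⟨M,X⟩ splits into μ₀ x₀ and the pairing of the blocks.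
    extend-weights : ∀ {X} → IsContraction X → Weights (block (conj M)) (tail μ) (block (conj X)) → Weights M μ X
    extend-weights {X} X-contr W = record
      { x           = x₀ ∷ W.x
      ; nonNegative = λ { zero → ≤-resp-≈ refl (sym (corner X)) (proj₁ (X-contr axis)) ; (suc i) → W.nonNegative i }
      ; ≤1          = λ { zero → ≤-resp-≈ (sym (corner X)) axis-normed (proj₂ (X-contr axis)) ; (suc i) → W.≤1 i }
      ; total≈trace = trans (+-congˡ W.total≈trace) (conj-trace X)
      ; pairing     = begin
          μ zero * x₀ + tail μ ⊙ W.x
            ≈⟨ +-cong (trans (*-congˡ (sym (𝟙-sumˡ zero (conj X zero)))) (*-distribˡ-sum (μ zero) (λ j → 𝟙 zero j * conj X zero j))) W.pairing ⟩
          sum (λ j → μ zero * (𝟙 zero j * conj X zero j)) + ⟪ block (conj M) , block (conj X) ⟫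
            ≈⟨ +-cong (sum-cong-≋ λ j → trans (sym (*-assoc (μ zero) (𝟙 zero j) (conj X zero j))) (*-congʳ {conj X zero j} (sym (first-row j))))
                 (sum-cong-≋ λ i → trans (sym (+-identityˡ (block (conj M) i ⊙ block (conj X) i))) (+-congʳ (sym (first-column i)))) ⟩
          ⟪ conj M , conj X ⟫
            ≈⟨ conj-⟪⟫ M X ⟩
          ⟪ M , X ⟫ ∎
      }
      where
      module W = Weights W
      x₀ = conj X zero zero
      first-column : ∀ i → conj M (suc i) zero * conj X (suc i) zero ≈ 0#
      first-column i = trans (*-congʳ {conj X (suc i) zero} (trans (conj-symmetric M-sym (suc i) zero) (trans (first-row (suc i)) (zeroʳ (μ zero)))))
        (zeroˡ (conj X (suc i) zero))

  weights : ∀ {n} {M : Matrix n} {μ} → IsSymmetric M → HasEigenvalues M μ → ∀ {X} → IsContraction X → Weights M μ X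
  weights {zero} M-sym M-eig X-contr = record
    { x = λ () ; nonNegative = λ () ; ≤1 = λ () ; total≈trace = refl ; pairing = refl }
  weights {suc n} {M} {μ} M-sym M-eig {X} X-contr = extend-weights M-sym D {X} X-contr
    (weights {M = block (conj M)} (λ i j → conj-symmetric M-sym (suc i) (suc j)) eigenvalues {block (conj X)}
      (block-contraction {X = conj X} (conj-contraction isReflection {X} X-contr)))
    where
    D : Deflation M μ
    D = deflate M-sym M-eig
    open Deflation D

  -- Extremal partial sums of eigenvalues

  NonIncreasing : ∀ {n} → Vector Carrier n → Set
  NonIncreasing μ = ∀ {i j} → i Fin.≤ j → μ j ≤ μ i

  UnitInterval : ∀ {n} → Vector Carrier n → Set
  UnitInterval x = ∀ i → 0# ≤ x i × x i ≤ 1#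

  sum-neg : ∀ {n} (f : Vector Carrier n) → sum (λ i → - f i) ≈ - sum f
  sum-neg f = trans (sum-cong-≋ λ i → solve 1 (λ x → :- x := (:- con (+ 1)) :* x) refl (f i))
    (trans (sym (*-distribˡ-sum (- 1#) f)) (solve 1 (λ x → (:- con (+ 1)) :* x := :- x) refl (sum f)))

  sumFirst-1 : ∀ {n} k → k ℕ.≤ n → sumFirst {n} k (λ _ → 1#) ≈ k · 1#
  sumFirst-1 {n}     zero    _           = sum-replicate-zero n
  sumFirst-1 {suc n} (suc k) (ℕ.s≤s k≤n) = +-congˡ (sumFirst-1 k k≤n)

  Separates : ∀ {n} → ℕ → Carrier → Vector Carrier n → Set
  Separates k p μ = ∀ i → (toℕ i ℕ.< k → p ≤ μ i) × (¬ toℕ i ℕ.< k → μ i ≤ p)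

  -- The k-th largest entry serves as the threshold. For k = 0 only an upper bound is asked for, and
  -- the list, being non-empty, has a largest entry.
  separator : ∀ {n k} {μ : Vector Carrier (suc n)} → NonIncreasing μ → k ℕ.≤ suc n → ∃[ p ] Separates k p μ
  separator {k = zero}  {μ} μ-noninc _ = μ zero , λ i → (λ ()) , λ _ → μ-noninc {zero} {i} ℕ.z≤n
  separator {k = suc k} {μ} μ-noninc k<n = μ pivot , λ i →
    (λ i<k → μ-noninc (ℕ.≤-trans (ℕ.s≤s⁻¹ i<k) (ℕ.≤-reflexive (≡.sym (toℕ-fromℕ< k<n))))) ,
    (λ i≮k → μ-noninc (ℕ.≤-trans (ℕ.≤-reflexive (toℕ-fromℕ< k<n)) (ℕ.≤-trans (ℕ.n≤1+n k) (ℕ.≮⇒≥ i≮k))))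
    where pivot = Fin.fromℕ< k<n

  -- With a threshold `p` between the first k entries and the rest, (μ_i - p)([i < k] - x_i) ≥ 0 for
  -- each i. In the sum over i the terms with `p` cancel because Σ x_i = k.
  weighted-sum≤sumFirst : ∀ {n k} {μ x : Vector Carrier (suc n)} → NonIncreasing μ → k ℕ.≤ suc n →
                          UnitInterval x → sum x ≈ k · 1# → μ ⊙ x ≤ sumFirst k μ
  weighted-sum≤sumFirst {n} {k} {μ} {x} μ-noninc k≤n x∈[0,1] Σx≈k = ≤-by
    (solve 3 (λ a b c → b :- a := con (+ 1) :* b :+ c :- (con (+ 1) :* a :+ c)) refl (μ ⊙ x) (sumFirst k μ) (p * (k · 1#)))
    (x≤y⇒0≤y-x (≤-resp-≈
      (trans (sum-linear 1# p (λ i → μ i * x i) (λ i → if does (toℕ i <? k) then 1# else 0#)) (+-congˡ (*-congˡ (sumFirst-1 k k≤n))))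
      (trans (sum-linear 1# p (λ i → if does (toℕ i <? k) then μ i else 0#) x) (+-congˡ (*-congˡ Σx≈k)))
      (sum-mono λ i → term i (toℕ i <? k))))
    where
    p = proj₁ (separator μ-noninc k≤n)
    separates = proj₂ (separator μ-noninc k≤n)
    term : ∀ i (i<?k : Dec (toℕ i ℕ.< k)) →
           1# * (μ i * x i) + p * (if does i<?k then 1# else 0#) ≤ 1# * (if does i<?k then μ i else 0#) + p * x i
    term i (yes i<k) = ≤-by
      (solve 3 (λ m x p → con (+ 1) :* m :+ p :* x :- (con (+ 1) :* (m :* x) :+ p :* con (+ 1)) := (m :- p) :* (con (+ 1) :- x)) refl (μ i) (x i) p)
      (*-nonNegative (x≤y⇒0≤y-x (proj₁ (separates i) i<k)) (x≤y⇒0≤y-x (proj₂ (x∈[0,1] i))))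
    term i (no i≮k) = ≤-by
      (solve 3 (λ m x p → con (+ 1) :* con (+ 0) :+ p :* x :- (con (+ 1) :* (m :* x) :+ p :* con (+ 0)) := (p :- m) :* x) refl (μ i) (x i) p)
      (*-nonNegative (x≤y⇒0≤y-x (proj₂ (separates i) i≮k)) (proj₁ (x∈[0,1] i)))

  opposite-antimono : ∀ {n} {i j : Fin n} → i Fin.≤ j → opposite j Fin.≤ opposite i
  opposite-antimono {n} {i} {j} i≤j = ≡.subst₂ ℕ._≤_ (≡.sym (opposite-prop j)) (≡.sym (opposite-prop i))
    (ℕ.∸-monoʳ-≤ n (ℕ.s≤s i≤j))

  sum-opposite : ∀ {n} (f : Vector Carrier n) → sum (λ i → f (opposite i)) ≈ sum f
  sum-opposite f = sym (sum-permute f reverse)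

  -- The upper bound applied to the reversed and negated list, which is again non-increasing.
  sumLast≤weighted-sum : ∀ {n k} {μ x : Vector Carrier (suc n)} → NonIncreasing μ → k ℕ.≤ suc n →
                         UnitInterval x → sum x ≈ k · 1# → sumLast k μ ≤ μ ⊙ x
  sumLast≤weighted-sum {n} {k} {μ} {x} μ-noninc k≤n x∈[0,1] Σx≈k = ≤-resp-≈
    (trans (trans (-‿cong (trans (sum-cong-≋ λ i → if-neg (toℕ i <? k) (μ (opposite i))) (sum-neg (λ i → if does (toℕ i <? k) then μ (opposite i) else 0#))))
      (-‿involutive (sumLast k μ))) refl)
    (trans (-‿cong (trans (sum-cong-≋ λ i → solve 2 (λ x y → (:- x) :* y := :- (x :* y)) refl (μ (opposite i)) (x (opposite i)))
      (trans (sum-neg (λ i → μ (opposite i) * x (opposite i))) (-‿cong (sum-opposite (λ i → μ i * x i)))))) (-‿involutive (μ ⊙ x)))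
    (neg-antimono-≤ (weighted-sum≤sumFirst {k = k} {λ i → - μ (opposite i)} {λ i → x (opposite i)}
      (λ i≤j → neg-antimono-≤ (μ-noninc (opposite-antimono i≤j))) k≤n
      (λ i → x∈[0,1] (opposite i)) (trans (sum-opposite x) Σx≈k)))
    where
    if-neg : ∀ {P : Set} (P? : Dec P) a → (if does P? then - a else 0#) ≈ - (if does P? then a else 0#)
    if-neg (yes _) a = refl
    if-neg (no _)  a = sym -0#≈0#

  -- Fractional colourings

  sumSubsets-cong : ∀ {n} {f g : Subset n → Carrier} → (∀ S → f S ≈ g S) → sumSubsets f ≈ sumSubsets g
  sumSubsets-cong {zero}  f≈g = f≈g Vec.[]
  sumSubsets-cong {suc n} f≈g = +-cong (sumSubsets-cong λ S → f≈g (outside Vec.∷ S)) (sumSubsets-cong λ S → f≈g (inside Vec.∷ S))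

  sumSubsets-mono : ∀ {n} {f g : Subset n → Carrier} → (∀ S → f S ≤ g S) → sumSubsets f ≤ sumSubsets g
  sumSubsets-mono {zero}  f≤g = f≤g Vec.[]
  sumSubsets-mono {suc n} f≤g = +-mono-≤ (sumSubsets-mono λ S → f≤g (outside Vec.∷ S)) (sumSubsets-mono λ S → f≤g (inside Vec.∷ S))

  sumSubsets-+ : ∀ {n} (f g : Subset n → Carrier) → sumSubsets (λ S → f S + g S) ≈ sumSubsets f + sumSubsets g
  sumSubsets-+ {zero}  f g = refl
  sumSubsets-+ {suc n} f g = trans
    (+-cong (sumSubsets-+ (λ S → f (outside Vec.∷ S)) (λ S → g (outside Vec.∷ S)))
            (sumSubsets-+ (λ S → f (inside Vec.∷ S)) (λ S → g (inside Vec.∷ S))))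
    (solve 4 (λ a b c d → a :+ b :+ (c :+ d) := a :+ c :+ (b :+ d)) refl _ _ _ _)

  *-distribˡ-sumSubsets : ∀ {n} a (f : Subset n → Carrier) → a * sumSubsets f ≈ sumSubsets (λ S → a * f S)
  *-distribˡ-sumSubsets {zero}  a f = refl
  *-distribˡ-sumSubsets {suc n} a f = trans (distribˡ a _ _)
    (+-cong (*-distribˡ-sumSubsets a (λ S → f (outside Vec.∷ S))) (*-distribˡ-sumSubsets a (λ S → f (inside Vec.∷ S))))

  sumSubsets-zero : ∀ {n} {f : Subset n → Carrier} → (∀ S → f S ≈ 0#) → sumSubsets f ≈ 0#
  sumSubsets-zero {zero}  f≈0 = f≈0 Vec.[]
  sumSubsets-zero {suc n} f≈0 = trans
    (+-cong (sumSubsets-zero λ S → f≈0 (outside Vec.∷ S)) (sumSubsets-zero λ S → f≈0 (inside Vec.∷ S))) (+-identityˡ 0#)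

  sumSubsets-nonNegative : ∀ {n} {f : Subset n → Carrier} → (∀ S → 0# ≤ f S) → 0# ≤ sumSubsets f
  sumSubsets-nonNegative {n} 0≤f = ≤-resp-≈ (sumSubsets-zero {n} {λ _ → 0#} λ _ → refl) refl (sumSubsets-mono 0≤f)

  sum-sumSubsets : ∀ {n m} (f : Fin m → Subset n → Carrier) →
                   sum (λ i → sumSubsets (f i)) ≈ sumSubsets (λ S → sum λ i → f i S)
  sum-sumSubsets {n} {zero}  f = sym (sumSubsets-zero {n} λ _ → refl)
  sum-sumSubsets {n} {suc m} f = trans (+-congˡ (sum-sumSubsets (tail f))) (sym (sumSubsets-+ (f zero) (λ S → sum λ i → f (suc i) S)))

  ⟪sumSubsets⟫ : ∀ {n} (F : Subset n → Matrix n) B →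
                 ⟪ (λ i j → sumSubsets λ S → F S i j) , B ⟫ ≈ sumSubsets (λ S → ⟪ F S , B ⟫)
  ⟪sumSubsets⟫ F B = trans
    (sum-cong-≋ λ i → trans
      (sum-cong-≋ λ j → trans (*-comm (sumSubsets λ S → F S i j) (B i j)) (trans (*-distribˡ-sumSubsets (B i j) (λ S → F S i j))
        (sumSubsets-cong λ S → *-comm (B i j) (F S i j))))
      (sum-sumSubsets (λ j S → F S i j * B i j)))
    (sum-sumSubsets (λ i S → F S i ⊙ B i))

  restrict : ∀ {n} → Vector Carrier n → Subset n → Vector Carrier n
  restrict u S i = if does (i ∈? S) then u i else 0#

  -- Restricting `p` as well lets Cauchy-Schwarz bound each summand by |p_S|² instead of |p|²; only
  -- the former add up to |p|² over the colouring.
  restrict-⊙ : ∀ {n} (u p : Vector Carrier n) S → restrict u S ⊙ p ≈ restrict u S ⊙ restrict p S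
  restrict-⊙ u p S = sum-cong-≋ λ i → term (i ∈? S) (u i) (p i)
    where
    term : ∀ {P : Set} (P? : Dec P) a b → (if does P? then a else 0#) * b ≈ (if does P? then a else 0#) * (if does P? then b else 0#)
    term (yes _) a b = refl
    term (no _)  a b = trans (zeroˡ b) (sym (zeroˡ 0#))

  ⟪outer,outer⟫ : ∀ {n} (u p : Vector Carrier n) → ⟪ outer u , outer p ⟫ ≈ (u ⊙ p) * (u ⊙ p)
  ⟪outer,outer⟫ u p = trans
    (sum-cong-≋ λ i → trans (sum-cong-≋ λ j → solve 4 (λ a b c d → a :* b :* (c :* d) := a :* c :* (b :* d)) refl (u i) (u j) (p i) (p j))
      (sym (*-distribˡ-sum (u i * p i) (λ j → u j * p j))))
    (sym (*-distribʳ-sum (u ⊙ p) (λ i → u i * p i)))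

  -- Cauchy–Schwarz, read off from |q - N (r·q) r|² ≥ 0.
  normalised-cauchy-schwarz : ∀ {n} (r q : Vector Carrier n) →
                              inv₀ (r ⊙ r) * ((r ⊙ q) * (r ⊙ q)) ≤ q ⊙ q
  normalised-cauchy-schwarz r q = ≤-by (sym (begin
    d ⊙ d
      ≈⟨ ⊙-linearʳ d 1# (- (N * B)) q r ⟩
    1# * (d ⊙ q) + - (N * B) * (d ⊙ r)
      ≈⟨ +-cong (*-congˡ (trans (⊙-comm d q) (⊙-linearʳ q 1# (- (N * B)) q r)))
                (*-congˡ (trans (⊙-comm d r) (⊙-linearʳ r 1# (- (N * B)) q r))) ⟩
    1# * (1# * (q ⊙ q) + - (N * B) * (q ⊙ r)) + - (N * B) * (1# * B + - (N * B) * A)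
      ≈⟨ +-congʳ (*-congˡ (+-congˡ (*-congˡ (⊙-comm q r)))) ⟩
    1# * (1# * (q ⊙ q) + - (N * B) * B) + - (N * B) * (1# * B + - (N * B) * A)
      ≈⟨ solve 4 (λ C N B A → con (+ 1) :* (con (+ 1) :* C :+ (:- (N :* B)) :* B) :+ (:- (N :* B)) :* (con (+ 1) :* B :+ (:- (N :* B)) :* A)
           := C :- (N :* (B :* B) :+ (N :- N :* N :* A) :* (B :* B))) refl (q ⊙ q) N B A ⟩
    q ⊙ q - (N * (B * B) + (N - N * N * A) * (B * B))
      ≈⟨ +-congˡ (-‿cong (trans (+-congˡ (trans (*-congʳ (x≈y⇒x-y≈0 (sym (inv₀-inv₀-x A)))) (zeroˡ (B * B)))) (+-identityʳ _))) ⟩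
    q ⊙ q - N * (B * B) ∎)) (⊙-nonNegative d)
    where
    open ≈-Reasoning
    A = r ⊙ r
    B = r ⊙ q
    N = inv₀ A
    d : Vector Carrier _
    d i = 1# * q i + - (N * B) * r i

  trace-𝟙 : ∀ n → trace (𝟙 {n}) ≈ n · 1#
  trace-𝟙 n = trans (sum-cong-≋ λ i → scalar-diagonal {n} 1# i) (sum-replicate n)

  -- The mixing parameter is t = (c - τ)/(m - τ), with τ the trace of the colour average and m that
  -- of the identity. If m = τ, then c = τ too, and the default t = 0 is right.
  fill-up : ∀ {τ c m} → τ ≤ c → c ≤ m → ∃[ t ] (0# ≤ t × t ≤ 1#) × (1# - t) * τ + t * m ≈ c
  fill-up {τ} {c} {m} τ≤c c≤m = t , (0≤t , t≤1) ,
    trans (solve 3 (λ t τ m → (con (+ 1) :- t) :* τ :+ t :* m := τ :+ t :* (m :- τ)) refl t τ m)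
      (trans (+-congˡ td≈e) (solve 2 (λ τ c → τ :+ (c :- τ) := c) refl τ c))
    where
    d = m - τ
    e = c - τ
    t = e * inv₀ d
    0≤e = x≤y⇒0≤y-x τ≤c
    0≤d = x≤y⇒0≤y-x (≤-trans τ≤c c≤m)
    e≤d : e ≤ d
    e≤d = +-mono-≤ c≤m ≤-refl
    0≤t = *-nonNegative 0≤e (inv₀-nonNegative 0≤d)
    t≤1 : t ≤ 1#
    t≤1 = ≤-trans (≤-resp-≈ (*-comm (inv₀ d) e) refl (*-monoˡ-≤ (inv₀-nonNegative 0≤d) e≤d)) (inv₀-x≤1 d)
    td≈e : t * d ≈ e
    td≈e with em {d ≈ 0#}
    ... | yes d≈0 = trans (*-congˡ d≈0) (trans (zeroʳ _) (sym (antisym (≤-resp-≈ refl d≈0 e≤d) 0≤e)))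
    ... | no  d≉0 = trans (*-assoc _ _ _) (trans (*-congˡ (trans (*-comm _ _) (proj₂ (inverse d d≉0)))) (*-identityʳ e))

  module _ {n} {G : SimpleGraph n} {y : Subset n → Carrier} (colouring : IsFractionalColouring G y) where
    open SimpleGraph G using (_~_; irrefl)
    open IsFractionalColouring colouring
    open ≈-Reasoning

    -- After interchanging the sums, coordinate i contributes p_i² times the total weight of the
    -- sets containing i, which is 1.
    covered-norm : ∀ p → sumSubsets (λ S → y S * (restrict p S ⊙ restrict p S)) ≈ p ⊙ p
    covered-norm p = begin
      sumSubsets (λ S → y S * (restrict p S ⊙ restrict p S))
        ≈⟨ sumSubsets-cong (λ S → trans (*-distribˡ-sum (y S) (λ i → restrict p S i * restrict p S i))
             (sum-cong-≋ λ i → term (i ∈? S) (y S) (p i))) ⟩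
      sumSubsets (λ S → sum λ i → p i * p i * (if does (i ∈? S) then y S else 0#))
        ≈⟨ sum-sumSubsets (λ i S → p i * p i * (if does (i ∈? S) then y S else 0#)) ⟨
      sum (λ i → sumSubsets λ S → p i * p i * (if does (i ∈? S) then y S else 0#))
        ≈⟨ sum-cong-≋ (λ i → trans (sym (*-distribˡ-sumSubsets (p i * p i) (λ S → if does (i ∈? S) then y S else 0#)))
             (trans (*-congˡ (covers i)) (*-identityʳ (p i * p i)))) ⟩
      p ⊙ p ∎
      where
      term : ∀ {P : Set} (P? : Dec P) a b →
             a * ((if does P? then b else 0#) * (if does P? then b else 0#)) ≈ b * b * (if does P? then a else 0#)
      term (yes _) a b = *-comm a (b * b)
      term (no _)  a b = solve 2 (λ a b → a :* (con (+ 0) :* con (+ 0)) := b :* b :* con (+ 0)) refl a b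

    module _ (u : Vector Carrier n) where

      normaliser : Subset n → Carrier
      normaliser S = inv₀ (restrict u S ⊙ restrict u S)

      -- Σ_S y_S u_S u_Sᵀ / |u_S|², where u_S is the restriction of u to S.
      colour-average : Matrix n
      colour-average i j = sumSubsets λ S → y S * (normaliser S * outer (restrict u S) i j)

      average-pairing : ∀ p → ⟪ colour-average , outer p ⟫ ≈
        sumSubsets (λ S → y S * (normaliser S * ((restrict u S ⊙ restrict p S) * (restrict u S ⊙ restrict p S))))
      average-pairing p = trans (⟪sumSubsets⟫ (λ S i j → y S * (normaliser S * outer (restrict u S) i j)) (outer p))
        (sumSubsets-cong λ S → begin
          ⟪ (λ i j → y S * (normaliser S * outer (restrict u S) i j)) , outer p ⟫
            ≈⟨ pull-out (y S) (normaliser S) (outer (restrict u S)) ⟩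
          y S * (normaliser S * ⟪ outer (restrict u S) , outer p ⟫)
            ≈⟨ *-congˡ (*-congˡ (trans (⟪outer,outer⟫ (restrict u S) p) (*-cong (restrict-⊙ u p S) (restrict-⊙ u p S)))) ⟩
          y S * (normaliser S * ((restrict u S ⊙ restrict p S) * (restrict u S ⊙ restrict p S))) ∎)
        where
        pull-out : ∀ a b A → ⟪ (λ i j → a * (b * A i j)) , outer p ⟫ ≈ a * (b * ⟪ A , outer p ⟫)
        pull-out a b A = trans
          (sum-cong-≋ λ i → trans (sum-cong-≋ λ j → solve 4 (λ a b x z → a :* (b :* x) :* z := a :* b :* (x :* z)) refl a b (A i j) (outer p i j))
            (sym (*-distribˡ-sum (a * b) (λ j → A i j * outer p i j))))
          (trans (sym (*-distribˡ-sum (a * b) (λ i → A i ⊙ outer p i))) (*-assoc a b ⟪ A , outer p ⟫))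

      normaliser-nonNegative : ∀ S → 0# ≤ normaliser S
      normaliser-nonNegative S = inv₀-nonNegative (⊙-nonNegative (restrict u S))

      -- Every summand is non-negative, and Cauchy-Schwarz bounds it by y_S |p_S|²; these bounds sum
      -- to |p|².
      average-contraction : IsContraction colour-average
      average-contraction p =
        ≤-resp-≈ refl (sym (average-pairing p)) (sumSubsets-nonNegative λ S →
          *-nonNegative (nonNegative S) (*-nonNegative (normaliser-nonNegative S) (square-nonNegative (restrict u S ⊙ restrict p S)))) ,
        ≤-resp-≈ (sym (average-pairing p)) (covered-norm p) (sumSubsets-mono λ S →
          *-monoˡ-≤ (nonNegative S) (normalised-cauchy-schwarz (restrict u S) (restrict p S)))

      -- The equality case of Cauchy-Schwarz in every summand, including those with u_S = 0, where
      -- both sides are 0.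
      average-attains : ⟪ colour-average , outer u ⟫ ≈ u ⊙ u
      average-attains = trans (average-pairing u) (trans
        (sumSubsets-cong λ S → *-congˡ {y S} (trans (sym (*-assoc (normaliser S) (A S) (A S))) (inv₀-x-x (A S))))
        (covered-norm u))
        where
        A : Subset n → Carrier
        A S = restrict u S ⊙ restrict u S

      -- A summand has trace y_S, or 0 if u_S = 0; hence only an inequality.
      average-trace : trace colour-average ≤ sumSubsets y
      average-trace = ≤-resp-≈ (sym trace≈) refl (sumSubsets-mono λ S → ≤-resp-≈ refl (*-identityʳ (y S))
        (*-monoˡ-≤ (nonNegative S) (inv₀-x≤1 (restrict u S ⊙ restrict u S))))
        where
        trace≈ : trace colour-average ≈ sumSubsets (λ S → y S * (normaliser S * (restrict u S ⊙ restrict u S)))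
        trace≈ = trans (sum-sumSubsets (λ i S → y S * (normaliser S * outer (restrict u S) i i)))
          (sumSubsets-cong λ S → trans
            (sym (*-distribˡ-sum (y S) (λ i → normaliser S * outer (restrict u S) i i)))
            (*-congˡ (sym (*-distribˡ-sum (normaliser S) (λ i → outer (restrict u S) i i)))))

      average-edges : ∀ {i j} → i ~ j → colour-average i j ≈ 0#
      average-edges {i} {j} i~j = sumSubsets-zero λ S → term S (i ∈? S) (j ∈? S)
        where
        term : ∀ S (i∈?S : Dec (i ∈ S)) (j∈?S : Dec (j ∈ S)) →
               y S * (normaliser S * ((if does i∈?S then u i else 0#) * (if does j∈?S then u j else 0#))) ≈ 0#
        -- A set containing both ends of an edge is not a coclique, so its weight is 0.
        term S (yes i∈S) (yes j∈S) = trans (*-congʳ (cocliques S λ coclique → coclique i j i∈S j∈S i~j)) (zeroˡ _)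
        term S (yes _)   (no _)    = solve 3 (λ y N a → y :* (N :* (a :* con (+ 0))) := con (+ 0)) refl (y S) (normaliser S) (u i)
        term S (no _)    j∈?S      = solve 3 (λ y N a → y :* (N :* (con (+ 0) :* a)) := con (+ 0)) refl (y S) (normaliser S) (if does j∈?S then u j else 0#)

    -- Mixing in the identity corrects the trace and preserves the rest: I is itself a contraction,
    -- vanishes on edges and attains |u|² at `u`.
    coclique-contraction : ∀ {c} → sumSubsets y ≤ c → c ≤ n · 1# → ∀ u →
      ∃[ X ] IsContraction X × trace X ≈ c × (∀ i j → i ~ j → X i j ≈ 0#) × ⟪ X , outer u ⟫ ≈ u ⊙ u
    coclique-contraction {c} Σy≤c c≤n u = X , contraction , trace≈c , edges , attains
      where
      Y = colour-average u
      filling = fill-up (≤-trans (average-trace u) Σy≤c) c≤n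
      t = proj₁ filling
      0≤t = proj₁ (proj₁ (proj₂ filling))
      0≤1-t = x≤y⇒0≤y-x (proj₂ (proj₁ (proj₂ filling)))
      X : Matrix n
      X i j = (1# - t) * Y i j + t * 𝟙 i j
      pairing : ∀ p → ⟪ X , outer p ⟫ ≈ (1# - t) * ⟪ Y , outer p ⟫ + t * (p ⊙ p)
      pairing p = begin
        ⟪ X , outer p ⟫                                              ≈⟨ ⟪⟫-comm X (outer p) ⟩
        ⟪ outer p , X ⟫                                              ≈⟨ ⟪⟫-linearʳ (outer p) (1# - t) t Y 𝟙 ⟩
        (1# - t) * ⟪ outer p , Y ⟫ + t * ⟪ outer p , 𝟙 ⟫             ≈⟨ +-cong (*-congˡ (⟪⟫-comm (outer p) Y))
          (*-congˡ (trans (⟪⟫-comm (outer p) 𝟙) (⟪𝟙,outer⟫ p))) ⟩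
        (1# - t) * ⟪ Y , outer p ⟫ + t * (p ⊙ p)                     ∎
      mix : ∀ x → (1# - t) * x + t * x ≈ x
      mix = solve 2 (λ t x → (con (+ 1) :- t) :* x :+ t :* x := x) refl t
      contraction : IsContraction X
      contraction p =
        ≤-resp-≈ refl (sym (pairing p)) (+-nonNegative (*-nonNegative 0≤1-t (proj₁ (average-contraction u p))) (*-nonNegative 0≤t (⊙-nonNegative p))) ,
        ≤-resp-≈ (sym (pairing p)) (mix (p ⊙ p)) (+-mono-≤ (*-monoˡ-≤ 0≤1-t (proj₂ (average-contraction u p))) ≤-refl)
      trace≈c : trace X ≈ c
      trace≈c = trans (sum-linear (1# - t) t (λ i → Y i i) (λ i → 𝟙 i i)) (trans (+-congˡ (*-congˡ (trace-𝟙 n))) (proj₂ (proj₂ filling)))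
      edges : ∀ i j → i ~ j → X i j ≈ 0#
      edges i j i~j = trans (+-cong (*-congˡ (average-edges u i~j)) (*-congˡ (scalar-off-diagonal 1# {i} {j} λ i≡j → irrefl i≡j i~j)))
        (solve 2 (λ s t → s :* con (+ 0) :+ t :* con (+ 0) := con (+ 0)) refl (1# - t) t)
      attains : ⟪ X , outer u ⟫ ≈ u ⊙ u
      attains = trans (pairing u) (trans (+-congʳ (*-congˡ (average-attains u))) (mix (u ⊙ u)))

  -- Existence of minima and the size of fractional colourings

  least : ∀ {P : ℕ → Set} m → P m → ∃[ k ] IsMinimum ℕ._≤_ P k × k ℕ.≤ m
  least {P} = <-rec _ λ m rec Pm → search m rec Pm (em {∃[ k ] k ℕ.< m × P k})
    where
    search : ∀ m → (∀ {k} → k ℕ.< m → P k → ∃[ j ] IsMinimum ℕ._≤_ P j × j ℕ.≤ k) → P m →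
             Dec (∃[ k ] k ℕ.< m × P k) → ∃[ k ] IsMinimum ℕ._≤_ P k × k ℕ.≤ m
    search m rec Pm (no none) = m , (Pm , λ k Pk → ℕ.≮⇒≥ λ k<m → none (k , k<m , Pk)) , ℕ.≤-refl
    search m rec Pm (yes (k , k<m , Pk)) =
      let j , j-least , j≤k = rec k<m Pk in j , j-least , ℕ.≤-trans j≤k (ℕ.<⇒≤ k<m)

  module _ {n} (G : SimpleGraph n) {y : Subset n → Carrier} (colouring : IsFractionalColouring G y) where
    open IsFractionalColouring colouring

    -- The sets through a single vertex already have total weight 1. This rules out the ceiling 0.
    1≤colouring : Fin n → 1# ≤ sumSubsets y
    1≤colouring v = ≤-resp-≈ (covers v) refl (sumSubsets-mono λ S → term (v ∈? S) (nonNegative S))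
      where
      term : ∀ {P : Set} (P? : Dec P) {a} → 0# ≤ a → (if does P? then a else 0#) ≤ a
      term (yes _) 0≤a = ≤-refl
      term (no _)  0≤a = 0≤a

    -- The empty set is a coclique that covers nothing, so a colouring may give it any non-negative
    -- weight; it is removed before the total is bounded.
    drop-empty : Subset n → Carrier
    drop-empty S = if does (nonempty? S) then y S else 0#

    drop-empty-colouring : IsFractionalColouring G drop-empty
    drop-empty-colouring = record
      { nonNegative = λ S → nonNeg (nonempty? S) (nonNegative S)
      ; cocliques   = λ S ¬coclique → vanish (nonempty? S) (cocliques S ¬coclique)
      ; covers      = λ v → trans (sumSubsets-cong λ S → agree S v (v ∈? S) (nonempty? S)) (covers v)
      }
      where
      nonNeg : ∀ {P : Set} (P? : Dec P) {a} → 0# ≤ a → 0# ≤ (if does P? then a else 0#)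
      nonNeg (yes _) 0≤a = 0≤a
      nonNeg (no _)  0≤a = ≤-refl
      vanish : ∀ {P : Set} (P? : Dec P) {a} → a ≈ 0# → (if does P? then a else 0#) ≈ 0#
      vanish (yes _) a≈0 = a≈0
      vanish (no _)  a≈0 = refl
      agree : ∀ S v (v∈?S : Dec (v ∈ S)) (S? : Dec (Nonempty S)) →
              (if does v∈?S then (if does S? then y S else 0#) else 0#) ≈ (if does v∈?S then y S else 0#)
      agree S v (no _)    _       = refl
      agree S v (yes _)   (yes _) = refl
      agree S v (yes v∈S) (no S∅) = contradiction (v , v∈S) S∅

    -- Adding the covering equations over all vertices counts each non-empty set at least once.
    drop-empty≤n : sumSubsets drop-empty ≤ n · 1#
    drop-empty≤n = ≤-resp-≈ refl
      (trans (sym (sum-sumSubsets (λ v S → if does (v ∈? S) then y S else 0#)))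
        (trans (sum-cong-≋ {n} covers) (sum-replicate n)))
      (sumSubsets-mono λ S → bound S (nonempty? S))
      where
      weight : Subset n → Vector Carrier n
      weight S v = if does (v ∈? S) then y S else 0#
      weight-nonNegative : ∀ S v → 0# ≤ weight S v
      weight-nonNegative S v with v ∈? S
      ... | yes _ = nonNegative S
      ... | no _  = ≤-refl
      weight-∈ : ∀ S v → v ∈ S → y S ≤ weight S v
      weight-∈ S v v∈S with v ∈? S
      ... | yes _   = ≤-refl
      ... | no v∉S  = contradiction v∈S v∉S
      bound : ∀ S (S? : Dec (Nonempty S)) → (if does S? then y S else 0#) ≤ sum (weight S)
      bound S (yes (v , v∈S)) = ≤-trans (weight-∈ S v v∈S) (term≤sum (weight-nonNegative S) v)
      bound S (no _)          = sum-nonNegative (weight-nonNegative S)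

  -- The bounds for ϑ and for h

  module _ {n} (G : SimpleGraph n) where
    open SimpleGraph G using (_~_)

    -- The supports are complementary. Adjacency is an arbitrary relation, so excluded middle
    -- separates the two cases.
    ⟪edges⟫≈0 : ∀ {Z X} → IsEdgeSupported G Z → (∀ i j → i ~ j → X i j ≈ 0#) → ⟪ Z , X ⟫ ≈ 0#
    ⟪edges⟫≈0 {Z} {X} Z-supp X≈0 = sum-zero λ i → sum-zero λ j → term i j (em {i ~ j})
      where
      term : ∀ i j → Dec (i ~ j) → Z i j * X i j ≈ 0#
      term i j (yes i~j) = trans (*-congˡ (X≈0 i j i~j)) (zeroʳ (Z i j))
      term i j (no i≁j)  = trans (*-congʳ (IsEdgeSupported.vanishing Z-supp i j i≁j)) (zeroˡ (X i j))

  module _ {n} (G : SimpleGraph (suc n)) {y : Subset (suc n) → Carrier} (colouring : IsFractionalColouring G y)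
           {c} (Σy≤c : sumSubsets y ≤ suc c · 1#) (c<n : suc c ℕ.≤ suc n) where
    open SimpleGraph G using (_~_)
    open ≈-Reasoning

    ·1-mono : ∀ {k m} → k ℕ.≤ m → k · 1# ≤ m · 1#
    ·1-mono {m = zero}  ℕ.z≤n       = ≤-refl
    ·1-mono {m = suc m} ℕ.z≤n       = +-nonNegative 0≤1 (·1-mono {m = m} ℕ.z≤n)
    ·1-mono             (ℕ.s≤s k≤m) = +-mono-≤ ≤-refl (·1-mono k≤m)

    -- Weak duality: ⟨M,X⟩ = Σ w for every admissible `Z`, and the minimiser provided by `IsTheta`
    -- is one of them.
    thetaDominates : ThetaDominates G (suc c)
    thetaDominates = ℕ.s≤s ℕ.z≤n , c<n , λ w 0≤w θ θ-theta → bound w (proj₁ θ-theta)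
      where
      bound : ∀ w {θ} → (∃[ r ] ∃[ Z ] ∃[ μ ] IsSqrt w r × IsEdgeSupported G Z ×
                IsSpectrum (λ i j → r i * r j + Z i j) μ × θ ≈ sumFirst (suc c) μ) → sum w ≤ θ
      bound w {θ} (r , Z , μ , (_ , r²≈w) , Z-supp , spectrum , θ≈) = ≤-resp-≈ pairing (sym θ≈)
        (weighted-sum≤sumFirst {k = suc c} {μ} nonIncreasing c<n (λ i → W.nonNegative i , W.≤1 i) (trans W.total≈trace trace≈c))
        where
        open IsSpectrum spectrum
        contraction = coclique-contraction colouring Σy≤c (·1-mono c<n) r
        X = proj₁ contraction
        trace≈c = proj₁ (proj₂ (proj₂ contraction))
        X-edges = proj₁ (proj₂ (proj₂ (proj₂ contraction)))
        attains = proj₂ (proj₂ (proj₂ (proj₂ contraction)))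
        M : Matrix (suc n)
        M i j = r i * r j + Z i j
        W : Weights M μ X
        W = weights (λ i j → +-cong (*-comm (r i) (r j)) (IsEdgeSupported.symmetric Z-supp i j)) roots (proj₁ (proj₂ contraction))
        module W = Weights W
        pairing : μ ⊙ W.x ≈ sum w
        pairing = begin
          μ ⊙ W.x                                  ≈⟨ W.pairing ⟩
          ⟪ M , X ⟫                                ≈⟨ ⟪⟫-cong {B = X} (λ i j → sym (+-cong (*-identityˡ (r i * r j)) (*-identityˡ (Z i j)))) (λ _ _ → refl) ⟩
          ⟪ (λ i j → 1# * outer r i j + 1# * Z i j) , X ⟫  ≈⟨ ⟪⟫-comm (λ i j → 1# * outer r i j + 1# * Z i j) X ⟩
          ⟪ X , (λ i j → 1# * outer r i j + 1# * Z i j) ⟫  ≈⟨ ⟪⟫-linearʳ X 1# 1# (outer r) Z ⟩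
          1# * ⟪ X , outer r ⟫ + 1# * ⟪ X , Z ⟫    ≈⟨ +-cong (trans (*-identityˡ _) attains)
            (trans (*-identityˡ _) (trans (⟪⟫-comm X Z) (⟪edges⟫≈0 G Z-supp X-edges))) ⟩
          r ⊙ r + 0#                               ≈⟨ +-identityʳ (r ⊙ r) ⟩
          r ⊙ r                                    ≈⟨ sum-cong-≋ r²≈w ⟩
          sum w                                    ∎

    -- With the ceiling written as `c + 1`, the top eigenvector uses up one unit of the trace and
    -- leaves `c`, which is the m - 1 of the condition.
    spectrallyBalanced : SpectrallyBalanced G (suc c)
    spectrallyBalanced = ℕ.s≤s ℕ.z≤n , c<n , bound
      where
      bound : ∀ Z → IsEdgeSupported G Z → ∀ μ → IsSpectrum Z μ → μ zero + sumLast c μ ≤ 0#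
      -- The top weight is replaced by 0 rather than dropped, since `sumLast` runs over the whole
      -- list. The term taken out is λ₁ itself, its weight having been 1.
      bound Z Z-supp μ spectrum = ≤-resp-≈ refl total≈0 (+-mono-≤ ≤-refl
        (sumLast≤weighted-sum {k = c} {μ} {0# ∷ tail W.x} nonIncreasing (ℕ.≤-trans (ℕ.n≤1+n c) c<n)
          (λ { zero → ≤-refl , 0≤1 ; (suc i) → W.nonNegative (suc i) , W.≤1 (suc i) }) total≈c))
        where
        open IsSpectrum spectrum
        Z-sym = IsEdgeSupported.symmetric Z-supp
        D : Deflation Z μ
        D = deflate Z-sym roots
        u = axis Z-sym D
        contraction = coclique-contraction colouring Σy≤c (·1-mono c<n) u
        X = proj₁ contraction
        X-contr = proj₁ (proj₂ contraction)
        trace≈c = proj₁ (proj₂ (proj₂ contraction))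
        X-edges = proj₁ (proj₂ (proj₂ (proj₂ contraction)))
        attains = proj₂ (proj₂ (proj₂ (proj₂ contraction)))
        open Deflation D
        W : Weights Z μ X
        -- One deflation is unfolded by hand: the first weight is then the corner of `conj X` for
        -- the same `D` from which `u` was taken.
        W = extend-weights Z-sym D {X} X-contr
          (weights {M = block (conj Z)} (λ i j → conj-symmetric Z-sym (suc i) (suc j)) eigenvalues {block (conj X)}
            (block-contraction {X = conj X} (conj-contraction isReflection {X} X-contr)))
        module W = Weights W
        x₀≈1 : W.x zero ≈ 1#
        x₀≈1 = trans (corner Z-sym D X) (trans attains (axis-normed Z-sym D))
        total≈c : 0# + sum (tail W.x) ≈ c · 1#
        total≈c = begin
          0# + sum (tail W.x)                   ≈⟨ solve 2 (λ x s → con (+ 0) :+ s := x :+ s :- x) refl (W.x zero) (sum (tail W.x)) ⟩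
          sum W.x - W.x zero                    ≈⟨ +-cong (trans W.total≈trace trace≈c) (-‿cong x₀≈1) ⟩
          1# + c · 1# - 1#                      ≈⟨ solve 2 (λ o s → o :+ s :- o := s) refl 1# (c · 1#) ⟩
          c · 1#                                ∎
        total≈0 : μ zero + μ ⊙ (0# ∷ tail W.x) ≈ 0#
        total≈0 = begin
          μ zero + (μ zero * 0# + tail μ ⊙ tail W.x)
            ≈⟨ solve 2 (λ m s → m :+ (m :* con (+ 0) :+ s) := m :* con (+ 1) :+ s) refl (μ zero) (tail μ ⊙ tail W.x) ⟩
          μ zero * 1# + tail μ ⊙ tail W.x       ≈⟨ +-congʳ (*-congˡ x₀≈1) ⟨
          μ ⊙ W.x                               ≈⟨ W.pairing ⟩
          ⟪ Z , X ⟫                             ≈⟨ ⟪edges⟫≈0 G Z-supp X-edges ⟩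
          0#                                    ∎

  chromatic-bounds : ∀ {n} (G : SimpleGraph (suc n)) χ → IsFractionalChromaticNumber G χ → ∀ c → IsCeiling χ c →
                     (∃[ k ] IsMinimum ℕ._≤_ (ThetaDominates G) k × k ℕ.≤ c) × (∃[ h ] IsH G h × h ℕ.≤ c)
  chromatic-bounds {n} G χ ((y , colouring , χ≈Σy) , χ-least) = λ
    -- A vertex exists, so χ_f ≥ 1 and the ceiling is a successor.
    { zero (χ≤0 , _) → contradiction (≤-trans (1≤colouring G colouring zero) (≤-resp-≈ χ≈Σy refl χ≤0)) 1≰0
    ; (suc c) (χ≤c , c-least) →
        let Σy≤c = ≤-resp-≈ χ≈Σy refl χ≤c
            -- Since χ_f is at most the total of the colouring without the empty set, the number of
            -- vertices is an upper bound of χ_f, and the ceiling is the least natural one.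
            c≤n = c-least (suc n) (≤-trans
              (χ-least _ (drop-empty G colouring , drop-empty-colouring G colouring , refl)) (drop-empty≤n G colouring))
        in least (suc c) (thetaDominates G colouring Σy≤c c≤n) , least (suc c) (spectrallyBalanced G colouring Σy≤c c≤n)
    }

open import Data.Nat.Base using (_≤_)

theorem5 : ExcludedMiddle 0ℓ → (ℝ : Reals) → let open Over ℝ in
    ∀ {n} .{{_ : NonZero n}} (G : SimpleGraph n) →
    ∀ χ → IsFractionalChromaticNumber G χ →
    ∀ ⌈χ⌉ → IsCeiling χ ⌈χ⌉ →
    (∃[ k ] IsMinimum _≤_ (ThetaDominates G) k × k ≤ ⌈χ⌉) ×
    (∃[ h ] IsH G h × h ≤ ⌈χ⌉)
theorem5 em ℝ {zero}  G = contradiction ≡.refl (ℕ.≢-nonZero⁻¹ 0)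
theorem5 em ℝ {suc n} G = Development.chromatic-bounds em ℝ G
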